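{- Every $3$-uniform family with $50$ distinct members contains a $4$-sunflower. Consequently, $f(3,4)\le49$.
   Context: A family is $3$-uniform if all its members are $3$-element sets (the ground set is an arbitrary finite set). A $k$-sunflower is a collection of $k$ distinct sets $A_1,\dots,A_k$ for which there is a set $C$ (the core, possibly empty) with $A_i\cap A_j=C$ for all $i\ne j$. $f(w,k)$ denotes the maximum size of a finite family of distinct $w$-element sets containing no $k$-sunflower. -}

module Defs where

open import Data.Fin using (Fin)
open import Data.Fin.Subset using (Subset; _∩_; ∣_∣)
open import Data.List using (List; length)
open import Data.List.Membership.Propositional using (_∈_)
open import Data.List.Relation.Unary.All using (All)
open import Data.List.Relation.Unary.Unique.Propositional using (Unique)
open import Data.Nat using (ℕ; _≤_)
open import Data.Product using (_×_; ∃-syntax)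
open import Function.Definitions using (Injective)
open import Relation.Binary.PropositionalEquality using (_≡_; _≢_)
open import Relation.Nullary using (¬_)

-- A finite ground set is represented by Fin n, with n arbitrary.
-- The uniqueness proof makes the length of the list the number of distinct
-- members of the family.
record Family (n : ℕ) : Set where
  field
    members  : List (Subset n)
    distinct : Unique members

  size : ℕ
  size = length members

open Family public

Uniform : ∀ {n} → ℕ → Family n → Set
Uniform w F = All (λ A → ∣ A ∣ ≡ w) (members F)

IsSunflower : ∀ {n} k → (Fin k → Subset n) → Set
IsSunflower {n} k A =
  Injective _≡_ _≡_ A ×
  (∃[ C ] (∀ i j → i ≢ j → A i ∩ A j ≡ C))

ContainsSunflower : ∀ {n} → ℕ → Family n → Set
ContainsSunflower {n} k F =
  ∃[ A ] (IsSunflower {n} k A × (∀ i → A i ∈ members F))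

-- IsSunflowerNumber w k m says that f(w,k) is defined and equals m.  It is a
-- relation because the maximum need not exist for every w and k: with k = 0
-- the empty collection is a sunflower, so no family avoids one.
-- The ground set varies along with the family.
IsSunflowerNumber : ℕ → ℕ → ℕ → Set
IsSunflowerNumber w k m =
  (∃[ n ] ∃[ F ] (Uniform {n} w F × ¬ ContainsSunflower k F × size F ≡ m)) ×
  (∀ n (F : Family n) → Uniform w F → ¬ ContainsSunflower k F → size F ≤ m)

{-# OPTIONS --safe #-}
module Submission where

-- Suppose 50 triples contain no 4-sunflower.  The link of a point is a graph
-- with maximum degree and matching number at most 3, hence has at most 10
-- edges, and if it is that large then many pairs of its edges touch.  Summing
-- over all points, on average a triple meets at most 23.2 of the 50 triples
-- (itself included), so it is disjoint from 26.8 others on average.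
--
-- On the other hand, the triples disjoint from two given disjoint triples
-- intersect pairwise, and a pairwise intersecting family has at most 10
-- members.  So in the graph of disjoint pairs every edge lies in at most 10
-- triangles.  Every triangle fgh satisfies
--   deg f + deg g + deg h ≤ 50 + codeg fg + codeg gh + codeg fh,
-- and summing this over all triangles bounds the average degree of such a
-- graph on 50 vertices by 50/3 + 10 = 26.66…, a contradiction.
--
-- For the existence of f(3,4), a family of at most 49 triples uses at most 147
-- points, so whether there is a sunflower-free family of a given size is
-- decidable.

open import Data.Bool using (Bool; true; false; not; _∧_; _∨_)
import Data.Bool.Properties as Bool
open import Data.Empty using (⊥-elim) renaming (⊥ to Empty)
open import Data.Fin using (Fin; zero; suc)
import Data.Fin.Properties as Fin
open import Data.Fin.Subset using (Subset; _∩_; ∣_∣; ⊥)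
open import Data.Fin.Subset.Properties using (∩-comm; anySubset?)
open import Data.List using (List; []; _∷_; length; map; filter; take)
import Data.List as List
open import Data.List.Membership.Propositional using (_∈_; _∉_; find; lose)
open import Data.List.Membership.Propositional.Properties using (∈-filter⁻; ∈-map⁺; ∈-map⁻; ∈-lookup)
import Data.List.Membership.DecPropositional as DecMembership
open import Data.List.Properties using (length-map; length-take)
open import Data.List.Relation.Unary.All using (All; []; _∷_)
import Data.List.Relation.Unary.All as All
import Data.List.Relation.Unary.All.Properties as All
open import Data.List.Relation.Unary.AllPairs using (AllPairs; []; _∷_)
import Data.List.Relation.Unary.AllPairs as AllPairs
import Data.List.Relation.Unary.AllPairs.Properties as AllPairs
open import Data.List.Relation.Unary.Any using (Any; here; there)
import Data.List.Relation.Unary.Any as Any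
open import Data.List.Relation.Unary.Unique.Propositional using (Unique)
import Data.List.Relation.Unary.Unique.Propositional.Properties as Unique
open import Data.Nat using (ℕ; zero; suc; _+_; _*_; _∸_; _≤_; _<_; z≤n; s≤s; _≤?_; _<?_) renaming (_≟_ to _≟ⁿ_)
open import Data.Nat.Divisibility using (_∣_; _∣?_; ∣m∣n⇒∣m+n; divides)
open import Data.Nat.Properties hiding (_≤?_; _<?_; _≟_)
open import Data.Nat.Tactic.RingSolver using (solve-∀)
open import Data.Product using (_×_; _,_; ∃-syntax; proj₁; proj₂)
open import Data.Sum using (_⊎_; inj₁; inj₂; [_,_]′)
open import Data.Vec using ([]; _∷_; lookup; updateAt; insertAt)
import Data.Vec.Properties as Vec
open import Function using (_∘_; id)
open import Relation.Binary.PropositionalEquality using (_≡_; _≢_; refl; sym; trans; cong; cong₂; subst; module ≡-Reasoning)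
open import Relation.Nullary using (¬_; Dec; yes; no; does; ¬?; _×-dec_)
open import Relation.Nullary.Decidable using (from-yes; from-no; map′; decidable-stable; dec-true; dec-false)
open import Relation.Unary using (Decidable)
open import Defs

-- The two estimates collide with little room: the links allow at most 1160 ordered touching pairs
-- out of 2500, so at least 1340 pairs are disjoint, while the graph of disjoint pairs allows only
-- 1332. An edge of a ten-edge link misses at most 7 others, which alone yields just 30 touching
-- pairs there; the argument uses 42. The gain comes from arithmetic: when every edge touches many
-- edges, degree 1 is excluded, the degrees 0, 2, 3 remain, and the number of edges then fixes the
-- sum of squared degrees modulo 6. In the disjointness graph the triangle inequality says nothing
-- about edges in few triangles. For those the plain bound deg f + deg g ≤ 50 + codeg fg is used,
-- with weight 10 - codeg fg. The weights are such that all sums involving codegrees cancel, and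
-- only a comparison of the sum of squared degrees with the sum of degrees is left.

private variable
  A B : Set
  n : ℕ

-- Linear arithmetic by certificate: a hypothesis l ≤ r implies x ≤ y as soon
-- as y − x and r − l agree up to the ring identity.
linear : ∀ {l r x y} → l ≤ r → x + r ≡ y + l → x ≤ y
linear {l} {r} {x} {y} l≤r eq = +-cancelʳ-≤ l x y (begin
  x + l ≤⟨ +-monoʳ-≤ x l≤r ⟩
  x + r ≡⟨ eq ⟩
  y + l ∎)
  where open ≤-Reasoning

⟦_⟧ : Bool → ℕ
⟦ true ⟧ = 1
⟦ false ⟧ = 0

⟦⟧-≤1 : ∀ b → ⟦ b ⟧ ≤ 1
⟦⟧-≤1 true = ≤-refl
⟦⟧-≤1 false = z≤n

⟦∧⟧ : ∀ a b → ⟦ a ∧ b ⟧ ≡ ⟦ a ⟧ * ⟦ b ⟧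
⟦∧⟧ true b = sym (+-identityʳ ⟦ b ⟧)
⟦∧⟧ false b = refl

∧-true : ∀ {a b} → a ∧ b ≡ true → a ≡ true × b ≡ true
∧-true {true} {true} _ = refl , refl

true-∧ : ∀ {a b} → a ≡ true → b ≡ true → a ∧ b ≡ true
true-∧ refl refl = refl

not-true : ∀ {a} → not a ≡ true → a ≡ false
not-true {false} _ = refl

false≢true : ∀ {a} → a ≡ false → a ≢ true
false≢true refl ()

≢true : ∀ {a} → a ≢ true → a ≡ false
≢true {true} h = ⊥-elim (h refl)
≢true {false} _ = refl

true? : ∀ a → a ≡ true ⊎ a ≡ false
true? true = inj₁ refl
true? false = inj₂ refl

-- Sums over lists

∑ : List A → (A → ℕ) → ℕ
∑ [] h = 0
∑ (x ∷ xs) h = h x + ∑ xs h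

∑-mono : ∀ (xs : List A) {g h} → (∀ {x} → x ∈ xs → g x ≤ h x) → ∑ xs g ≤ ∑ xs h
∑-mono [] g≤h = z≤n
∑-mono (x ∷ xs) g≤h = +-mono-≤ (g≤h (here refl)) (∑-mono xs (g≤h ∘ there))

∑-cong : ∀ (xs : List A) {g h} → (∀ {x} → x ∈ xs → g x ≡ h x) → ∑ xs g ≡ ∑ xs h
∑-cong [] g≡h = refl
∑-cong (x ∷ xs) g≡h = cong₂ _+_ (g≡h (here refl)) (∑-cong xs (g≡h ∘ there))

∑-+ : ∀ (xs : List A) g h → ∑ xs (λ x → g x + h x) ≡ ∑ xs g + ∑ xs h
∑-+ [] g h = refl
∑-+ (x ∷ xs) g h rewrite ∑-+ xs g h = lemma (g x) (h x) (∑ xs g) (∑ xs h)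
  where
  lemma : ∀ a b c d → a + b + (c + d) ≡ a + c + (b + d)
  lemma = solve-∀

∑-* : ∀ (xs : List A) c h → ∑ xs (λ x → c * h x) ≡ c * ∑ xs h
∑-* [] c h = sym (*-zeroʳ c)
∑-* (x ∷ xs) c h rewrite ∑-* xs c h = sym (*-distribˡ-+ c (h x) (∑ xs h))

∑-const : ∀ (xs : List A) c → ∑ xs (λ _ → c) ≡ length xs * c
∑-const [] c = refl
∑-const (x ∷ xs) c = cong (c +_) (∑-const xs c)

∑-zero : ∀ (xs : List A) → ∑ xs (λ _ → 0) ≡ 0
∑-zero xs = trans (∑-const xs 0) (*-zeroʳ (length xs))

∑-swap : ∀ (xs : List A) (ys : List B) (h : A → B → ℕ) →
         ∑ xs (λ x → ∑ ys (h x)) ≡ ∑ ys (λ y → ∑ xs (λ x → h x y))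
∑-swap [] ys h = sym (∑-zero ys)
∑-swap (x ∷ xs) ys h = trans (cong (∑ ys (h x) +_) (∑-swap xs ys h))
                             (sym (∑-+ ys (h x) (λ y → ∑ xs (λ x → h x y))))

∑-≤const : ∀ (xs : List A) {h} c → (∀ {x} → x ∈ xs → h x ≤ c) → ∑ xs h ≤ length xs * c
∑-≤const xs c h≤c = ≤-trans (∑-mono xs h≤c) (≤-reflexive (∑-const xs c))

∑-≥const : ∀ (xs : List A) {h} c → (∀ {x} → x ∈ xs → c ≤ h x) → length xs * c ≤ ∑ xs h
∑-≥const xs c c≤h = ≤-trans (≤-reflexive (sym (∑-const xs c))) (∑-mono xs c≤h)

∑-∈ : ∀ {xs : List A} {h x} → x ∈ xs → h x ≤ ∑ xs h
∑-∈ (here refl) = m≤m+n _ _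
∑-∈ (there x∈xs) = ≤-trans (∑-∈ x∈xs) (m≤n+m _ _)

∑-map : ∀ (φ : A → B) xs h → ∑ (map φ xs) h ≡ ∑ xs (h ∘ φ)
∑-map φ [] h = refl
∑-map φ (x ∷ xs) h = cong (h (φ x) +_) (∑-map φ xs h)

-- Counting

# : List A → (A → Bool) → ℕ
# xs P = ∑ xs (λ x → ⟦ P x ⟧)

select : (A → Bool) → List A → List A
select P = filter (λ x → P x Bool.≟ true)

∑-select : ∀ (P : A → Bool) xs h → ∑ (select P xs) h ≡ ∑ xs (λ x → ⟦ P x ⟧ * h x)
∑-select P [] h = refl
∑-select P (x ∷ xs) h with P x
... | true = cong₂ _+_ (sym (+-identityʳ (h x))) (∑-select P xs h)
... | false = ∑-select P xs h

length-∑ : ∀ (xs : List A) → ∑ xs (λ _ → 1) ≡ length xs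
length-∑ xs = trans (∑-const xs 1) (*-identityʳ (length xs))

length-select : ∀ (P : A → Bool) xs → length (select P xs) ≡ # xs P
length-select P xs = begin
  length (select P xs)        ≡⟨ length-∑ (select P xs) ⟨
  ∑ (select P xs) (λ _ → 1)   ≡⟨ ∑-select P xs (λ _ → 1) ⟩
  ∑ xs (λ x → ⟦ P x ⟧ * 1)    ≡⟨ ∑-cong xs (λ {x} _ → *-identityʳ ⟦ P x ⟧) ⟩
  # xs P                      ∎
  where open ≡-Reasoning

#-select : ∀ (P : A → Bool) Q xs → # (select P xs) Q ≡ # xs (λ x → P x ∧ Q x)
#-select P Q xs = trans (∑-select P xs (λ x → ⟦ Q x ⟧)) (∑-cong xs (λ {x} _ → sym (⟦∧⟧ (P x) (Q x))))

∈-select⁻ : ∀ (P : A → Bool) xs {x} → x ∈ select P xs → x ∈ xs × P x ≡ true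
∈-select⁻ P xs = ∈-filter⁻ (λ x → P x Bool.≟ true)

#-mono : ∀ (xs : List A) {P Q : A → Bool} → (∀ {x} → x ∈ xs → P x ≡ true → Q x ≡ true) → # xs P ≤ # xs Q
#-mono xs {P} {Q} P⇒Q = ∑-mono xs pointwise
  where
  pointwise : ∀ {x} → x ∈ xs → ⟦ P x ⟧ ≤ ⟦ Q x ⟧
  pointwise {x} x∈xs with P x in eq
  ... | false = z≤n
  ... | true rewrite P⇒Q x∈xs eq = ≤-refl

#-cover : ∀ {A : Set} (xs : List A) (P : A → Bool) (Qs : List (A → Bool)) →
          (∀ {x} → x ∈ xs → P x ≡ true → Any (λ Q → Q x ≡ true) Qs) →
          # xs P ≤ ∑ Qs (# xs)
#-cover {A} xs P Qs cover = ≤-trans (∑-mono xs pointwise) (≤-reflexive (∑-swap xs Qs (λ x Q → ⟦ Q x ⟧)))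
  where
  any : ∀ {Qs : List (A → Bool)} {x : A} → Any (λ Q → Q x ≡ true) Qs → 1 ≤ ∑ Qs (λ Q → ⟦ Q x ⟧)
  any {Q ∷ Qs} (here eq) rewrite eq = s≤s z≤n
  any {Q ∷ Qs} (there h) = ≤-trans (any h) (m≤n+m _ _)
  pointwise : ∀ {x} → x ∈ xs → ⟦ P x ⟧ ≤ ∑ Qs (λ Q → ⟦ Q x ⟧)
  pointwise {x} x∈xs with P x in eq
  ... | false = z≤n
  ... | true = any (cover x∈xs eq)

#-split : ∀ (xs : List A) (P Q : A → Bool) → # xs P ≡ # xs (λ x → P x ∧ Q x) + # xs (λ x → P x ∧ not (Q x))
#-split xs P Q = trans (∑-cong xs (λ {x} _ → lemma (P x) (Q x))) (∑-+ xs _ _)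
  where
  lemma : ∀ a b → ⟦ a ⟧ ≡ ⟦ a ∧ b ⟧ + ⟦ a ∧ not b ⟧
  lemma false _ = refl
  lemma true true = refl
  lemma true false = refl

length-split : ∀ (xs : List A) (P : A → Bool) → length xs ≡ # xs P + # xs (not ∘ P)
length-split xs P = trans (sym (length-∑ xs)) (#-split xs (λ _ → true) P)

#-∈ : ∀ {xs : List A} {P : A → Bool} {x} → x ∈ xs → P x ≡ true → 1 ≤ # xs P
#-∈ {xs = xs} {P} {x} x∈xs Px = subst (λ b → ⟦ b ⟧ ≤ # xs P) Px (∑-∈ {h = λ x → ⟦ P x ⟧} x∈xs)

search : ∀ (xs : List A) (P : A → Bool) → (∃[ x ] x ∈ xs × P x ≡ true) ⊎ (∀ {x} → x ∈ xs → P x ≡ false)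
search [] P = inj₂ λ ()
search (x ∷ xs) P with P x in eq | search xs P
... | true | _ = inj₁ (x , here refl , eq)
... | false | inj₁ (y , y∈xs , Py) = inj₁ (y , there y∈xs , Py)
... | false | inj₂ none = inj₂ λ { (here refl) → eq ; (there x∈xs) → none x∈xs }

#-none : ∀ (xs : List A) (P : A → Bool) → (∀ {x} → x ∈ xs → P x ≡ false) → # xs P ≡ 0
#-none xs P none = trans (∑-cong xs (λ x∈xs → cong ⟦_⟧ (none x∈xs))) (∑-zero xs)

#-all : ∀ (xs : List A) (P : A → Bool) → (∀ {x} → x ∈ xs → P x ≡ true) → # xs P ≡ length xs
#-all xs P all = trans (∑-cong xs (λ x∈xs → cong ⟦_⟧ (all x∈xs))) (length-∑ xs)

-- Sums over the ground set

∑ᶠ : (Fin n → ℕ) → ℕ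
∑ᶠ {zero} h = 0
∑ᶠ {suc n} h = h zero + ∑ᶠ (h ∘ suc)

∑ᶠ-mono : {g h : Fin n → ℕ} → (∀ u → g u ≤ h u) → ∑ᶠ g ≤ ∑ᶠ h
∑ᶠ-mono {zero} g≤h = z≤n
∑ᶠ-mono {suc n} g≤h = +-mono-≤ (g≤h zero) (∑ᶠ-mono (g≤h ∘ suc))

∑ᶠ-cong : {g h : Fin n → ℕ} → (∀ u → g u ≡ h u) → ∑ᶠ g ≡ ∑ᶠ h
∑ᶠ-cong {zero} g≡h = refl
∑ᶠ-cong {suc n} g≡h = cong₂ _+_ (g≡h zero) (∑ᶠ-cong (g≡h ∘ suc))

∑ᶠ-+ : (g h : Fin n → ℕ) → ∑ᶠ (λ u → g u + h u) ≡ ∑ᶠ g + ∑ᶠ h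
∑ᶠ-+ {zero} g h = refl
∑ᶠ-+ {suc n} g h rewrite ∑ᶠ-+ (g ∘ suc) (h ∘ suc) = lemma (g zero) (h zero) (∑ᶠ (g ∘ suc)) (∑ᶠ (h ∘ suc))
  where
  lemma : ∀ a b c d → a + b + (c + d) ≡ a + c + (b + d)
  lemma = solve-∀

∑ᶠ-* : ∀ c (h : Fin n → ℕ) → ∑ᶠ (λ u → c * h u) ≡ c * ∑ᶠ h
∑ᶠ-* {zero} c h = sym (*-zeroʳ c)
∑ᶠ-* {suc n} c h rewrite ∑ᶠ-* c (h ∘ suc) = sym (*-distribˡ-+ c (h zero) (∑ᶠ (h ∘ suc)))

∑ᶠ-zero : ∀ n → ∑ᶠ {n} (λ _ → 0) ≡ 0
∑ᶠ-zero zero = refl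
∑ᶠ-zero (suc n) = ∑ᶠ-zero n

∑ᶠ-swap : (xs : List A) (h : Fin n → A → ℕ) → ∑ᶠ (λ u → ∑ xs (h u)) ≡ ∑ xs (λ x → ∑ᶠ (λ u → h u x))
∑ᶠ-swap {n = n} [] h = ∑ᶠ-zero n
∑ᶠ-swap (x ∷ xs) h = trans (∑ᶠ-+ (λ u → h u x) (λ u → ∑ xs (h u))) (cong (∑ᶠ (λ u → h u x) +_) (∑ᶠ-swap xs h))

∑ᶠ-∈ : (h : Fin n → ℕ) (u : Fin n) → h u ≤ ∑ᶠ h
∑ᶠ-∈ h zero = m≤m+n _ _
∑ᶠ-∈ h (suc u) = ≤-trans (∑ᶠ-∈ (h ∘ suc) u) (m≤n+m _ _)

∑ᶠ-∈₂ : (h : Fin n → ℕ) {u v : Fin n} → u ≢ v → h u + h v ≤ ∑ᶠ h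
∑ᶠ-∈₂ h {zero} {zero} u≢v = ⊥-elim (u≢v refl)
∑ᶠ-∈₂ h {zero} {suc v} u≢v = +-monoʳ-≤ (h zero) (∑ᶠ-∈ (h ∘ suc) v)
∑ᶠ-∈₂ h {suc u} {zero} u≢v = ≤-trans (≤-reflexive (+-comm _ (h zero))) (+-monoʳ-≤ (h zero) (∑ᶠ-∈ (h ∘ suc) u))
∑ᶠ-∈₂ h {suc u} {suc v} u≢v = ≤-trans (∑ᶠ-∈₂ (h ∘ suc) (u≢v ∘ cong suc)) (m≤n+m _ _)

-- Subsets as Boolean vectors: touching, toggling a point, listing the points

_≟ˢ_ : (f g : Subset n) → Dec (f ≡ g)
_≟ˢ_ = Vec.≡-dec Bool._≟_

_∋_ : Subset n → Fin n → Set
f ∋ v = lookup f v ≡ true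

_∌_ : Subset n → Fin n → Set
f ∌ v = lookup f v ≡ false

∋-∌⇒≢ : ∀ (f : Subset n) {u v} → f ∋ u → f ∌ v → u ≢ v
∋-∌⇒≢ f fu fv refl = false≢true fv fu

touch : Subset n → Subset n → Bool
touch [] [] = false
touch (a ∷ f) (b ∷ g) = (a ∧ b) ∨ touch f g

miss : Subset n → Subset n → Bool
miss f g = not (touch f g)

touch-sym : ∀ (f g : Subset n) → touch f g ≡ touch g f
touch-sym [] [] = refl
touch-sym (a ∷ f) (b ∷ g) = cong₂ _∨_ (Bool.∧-comm a b) (touch-sym f g)

touch⁻ : ∀ (f g : Subset n) → touch f g ≡ true → ∃[ v ] f ∋ v × g ∋ v
touch⁻ [] [] ()
touch⁻ (true ∷ f) (true ∷ g) h = zero , refl , refl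
touch⁻ (true ∷ f) (false ∷ g) h = let v , p , q = touch⁻ f g h in suc v , p , q
touch⁻ (false ∷ f) (b ∷ g) h = let v , p , q = touch⁻ f g h in suc v , p , q

touch⁺ : ∀ (f g : Subset n) v → f ∋ v → g ∋ v → touch f g ≡ true
touch⁺ (_ ∷ f) (_ ∷ g) zero refl refl = refl
touch⁺ (a ∷ f) (b ∷ g) (suc v) p q rewrite touch⁺ f g v p q = Bool.∨-zeroʳ (a ∧ b)

touch-false⁻ : ∀ (f g : Subset n) → touch f g ≡ false → ∀ v → f ∋ v → g ∌ v
touch-false⁻ f g h v fv = ≢true λ gv → false≢true h (touch⁺ f g v fv gv)

touch-false⇒∩≡⊥ : ∀ (f g : Subset n) → touch f g ≡ false → f ∩ g ≡ ⊥
touch-false⇒∩≡⊥ [] [] _ = refl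
touch-false⇒∩≡⊥ (true ∷ f) (true ∷ g) ()
touch-false⇒∩≡⊥ (true ∷ f) (false ∷ g) h = cong (false ∷_) (touch-false⇒∩≡⊥ f g h)
touch-false⇒∩≡⊥ (false ∷ f) (b ∷ g) h = cong (false ∷_) (touch-false⇒∩≡⊥ f g h)

-- Toggling v removes it from the sets containing it; unlike removal, this is
-- injective on all subsets.
flip : Fin n → Subset n → Subset n
flip v f = updateAt f v not

flip-involutive : ∀ v (f : Subset n) → flip v (flip v f) ≡ f
flip-involutive v f = trans (Vec.updateAt-updateAt v f) (Vec.updateAt-id-local v f (Bool.not-involutive _))

flip-injective : ∀ v {f g : Subset n} → flip v f ≡ flip v g → f ≡ g
flip-injective v {f} {g} h = trans (sym (flip-involutive v f)) (trans (cong (flip v) h) (flip-involutive v g))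

lookup-flip-≢ : ∀ {u v} (f : Subset n) → u ≢ v → lookup (flip v f) u ≡ lookup f u
lookup-flip-≢ {u = u} {v} f u≢v = Vec.lookup∘updateAt′ u v u≢v f

lookup-flip-≡ : ∀ v (f : Subset n) → lookup (flip v f) v ≡ not (lookup f v)
lookup-flip-≡ v f = Vec.lookup∘updateAt v f

flip-∌ : ∀ v (f : Subset n) → f ∋ v → flip v f ∌ v
flip-∌ v f fv rewrite lookup-flip-≡ v f | fv = refl

flip-∩ : ∀ v (f g : Subset n) → f ∋ v → g ∋ v → flip v f ∩ flip v g ≡ flip v (f ∩ g)
flip-∩ zero (_ ∷ f) (_ ∷ g) refl refl = refl
flip-∩ (suc v) (a ∷ f) (b ∷ g) p q = cong (_ ∷_) (flip-∩ v f g p q)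

∣flip∣ : ∀ v (f : Subset n) → f ∋ v → suc ∣ flip v f ∣ ≡ ∣ f ∣
∣flip∣ zero (_ ∷ f) refl = refl
∣flip∣ (suc v) (true ∷ f) p = cong suc (∣flip∣ v f p)
∣flip∣ (suc v) (false ∷ f) p = ∣flip∣ v f p

∑ᶠ-flip : ∀ v (f : Subset n) (h : Fin n → ℕ) → f ∋ v →
          ∑ᶠ (λ u → ⟦ lookup f u ⟧ * h u) ≡ h v + ∑ᶠ (λ u → ⟦ lookup (flip v f) u ⟧ * h u)
∑ᶠ-flip zero (_ ∷ f) h refl = cong (_+ ∑ᶠ (λ u → ⟦ lookup f u ⟧ * h (suc u))) (+-identityʳ (h zero))
∑ᶠ-flip (suc v) (a ∷ f) h p rewrite ∑ᶠ-flip v f (h ∘ suc) p =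
  lemma (⟦ a ⟧ * h zero) (h (suc v)) (∑ᶠ (λ u → ⟦ lookup (flip v f) u ⟧ * h (suc u)))
  where
  lemma : ∀ a b c → a + (b + c) ≡ b + (a + c)
  lemma = solve-∀

∣∣≡0 : ∀ (f : Subset n) → ∣ f ∣ ≡ 0 → f ≡ ⊥
∣∣≡0 [] _ = refl
∣∣≡0 (false ∷ f) h = cong (false ∷_) (∣∣≡0 f h)

∣∣≡suc : ∀ (f : Subset n) {w} → ∣ f ∣ ≡ suc w → ∃[ v ] f ∋ v
∣∣≡suc (true ∷ f) h = zero , refl
∣∣≡suc (false ∷ f) h = let v , p = ∣∣≡suc f h in suc v , p

⊥-∌ : ∀ (v : Fin n) → ⊥ ∌ v
⊥-∌ v = Vec.lookup-replicate v false

-- The field `sum` evaluates a sum over the ground set weighted by the indicator of `f`, the form in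
-- which double counting of incidences produces sums.
record Elements (f : Subset n) (vs : List (Fin n)) : Set where
  field
    unrepeated : Unique vs
    elements-∋  : All (f ∋_) vs
    complete : ∀ {u} → f ∋ u → u ∈ vs
    sum      : ∀ h → ∑ᶠ (λ u → ⟦ lookup f u ⟧ * h u) ≡ ∑ vs h

elements : ∀ w (f : Subset n) → ∣ f ∣ ≡ w → ∃[ vs ] length vs ≡ w × Elements f vs
elements {n} zero f h rewrite ∣∣≡0 f h = [] , refl , record
  { unrepeated = []
  ; elements-∋ = []
  ; complete = λ {u} p → ⊥-elim (false≢true (⊥-∌ u) p)
  ; sum = λ h → trans (∑ᶠ-cong (λ u → cong (λ b → ⟦ b ⟧ * h u) (⊥-∌ u))) (∑ᶠ-zero n)
  }
elements {n} (suc w) f h with ∣∣≡suc f h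
... | v , fv with elements w (flip v f) (suc-injective (trans (∣flip∣ v f fv) h))
... | vs , len , E = v ∷ vs , cong suc len , record
  { unrepeated = All.map (λ p q → false≢true (flip-∌ v f fv) (subst (flip v f ∋_) (sym q) p)) (Elements.elements-∋ E) ∷ Elements.unrepeated E
  ; elements-∋ = fv ∷ All.map old (Elements.elements-∋ E)
  ; complete = complete
  ; sum = λ h → trans (∑ᶠ-flip v f h fv) (cong (h v +_) (Elements.sum E h))
  }
  where
  old : ∀ {u} → flip v f ∋ u → f ∋ u
  old {u} p with u Fin.≟ v
  ... | yes refl = fv
  ... | no u≢v = trans (sym (lookup-flip-≢ f u≢v)) p
  complete : ∀ {u} → f ∋ u → u ∈ v ∷ vs
  complete {u} p with u Fin.≟ v
  ... | yes u≡v = here u≡v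
  ... | no u≢v = there (Elements.complete E (trans (lookup-flip-≢ f u≢v) p))

-- Finding elements in a list without repetitions

#-≡ : ∀ {xs : List (Subset n)} → Unique xs → ∀ a → # xs (λ f → does (f ≟ˢ a)) ≤ 1
#-≡ [] a = z≤n
#-≡ {xs = x ∷ xs} (x∉xs ∷ xs!) a with x ≟ˢ a
... | no _ = #-≡ xs! a
... | yes refl rewrite #-none xs (λ f → does (f ≟ˢ x)) (λ {f} f∈xs → dec-false (f ≟ˢ x) (λ f≡x → All.lookup x∉xs f∈xs (sym f≡x))) = ≤-refl

-- Each entry of `L` excludes at most one member, because `xs` has no repetitions. This is how
-- second, third and fourth members are chosen below.
avoid : ∀ {xs : List (Subset n)} → Unique xs → ∀ (P : Subset n → Bool) L → length L < # xs P →
        ∃[ f ] f ∈ xs × P f ≡ true × f ∉ L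
avoid {n} {xs} xs! P L L<P with search xs (λ f → P f ∧ not (does (DecMembership._∈?_ _≟ˢ_ f L)))
... | inj₁ (f , f∈xs , h) = f , f∈xs , proj₁ (∧-true h) , λ f∈L →
  false≢true (cong not (dec-true (DecMembership._∈?_ _≟ˢ_ f L) f∈L)) (proj₂ (∧-true {P f} h))
... | inj₂ none = ⊥-elim (<⇒≱ L<P (≤-trans cover (≤-trans (∑-≤const L 1 (λ {a} _ → #-≡ xs! a)) (≤-reflexive (*-identityʳ _)))))
  where
  is : Subset n → Subset n → Bool
  is a f = does (f ≟ˢ a)
  in-L : ∀ {f} → f ∈ xs → P f ≡ true → f ∈ L
  in-L {f} f∈xs Pf = decidable-stable (DecMembership._∈?_ _≟ˢ_ f L) λ f∉L →
    false≢true (none f∈xs) (true-∧ Pf (cong not (dec-false (DecMembership._∈?_ _≟ˢ_ f L) f∉L)))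
  any-≡ : ∀ {f L} → f ∈ L → Any (λ Q → Q f ≡ true) (map is L)
  any-≡ {f} (here refl) = here (dec-true (f ≟ˢ f) refl)
  any-≡ (there p) = there (any-≡ p)
  cover : # xs P ≤ ∑ L (λ a → # xs (is a))
  cover = ≤-trans (#-cover xs P (map is L) (λ f∈xs Pf → any-≡ (in-L f∈xs Pf)))
                  (≤-reflexive (∑-map is L (# xs)))

#-∈₂ : ∀ {A : Set} {xs : List A} {P : A → Bool} {f g} → f ∈ xs → g ∈ xs → f ≢ g → P f ≡ true → P g ≡ true → 2 ≤ # xs P
#-∈₂ (here refl) (here refl) f≢g _ _ = ⊥-elim (f≢g refl)
#-∈₂ (here refl) (there g∈) _ Pf Pg rewrite Pf = s≤s (#-∈ g∈ Pg)
#-∈₂ (there f∈) (here refl) _ Pf Pg rewrite Pg = s≤s (#-∈ f∈ Pf)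
#-∈₂ {P = P} (there f∈) (there g∈) f≢g Pf Pg = ≤-trans (#-∈₂ {P = P} f∈ g∈ f≢g Pf Pg) (m≤n+m _ _)

#≤1⇒≡ : ∀ {xs : List (Subset n)} P {f g} → # xs P ≤ 1 → f ∈ xs → g ∈ xs → P f ≡ true → P g ≡ true → f ≡ g
#≤1⇒≡ P {f} {g} h f∈ g∈ Pf Pg = decidable-stable (f ≟ˢ g) λ f≢g → <⇒≱ (#-∈₂ {P = P} f∈ g∈ f≢g Pf Pg) h

-- Uniform families without 4-sunflowers

-- Sunflowers are repetition-free lists here, not injections from `Fin 4`: such lists pass easily
-- through `map`, and subfamilies inherit the property by inclusion alone.
SunflowerFree : List (Subset n) → Set
SunflowerFree xs = ∀ C ys → length ys ≡ 4 → All (_∈ xs) ys → Unique ys → ¬ AllPairs (λ f g → f ∩ g ≡ C) ys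

record Free (w : ℕ) (xs : List (Subset n)) : Set where
  field
    unique  : Unique xs
    uniform : ∀ {f} → f ∈ xs → ∣ f ∣ ≡ w
    free    : SunflowerFree xs

open Free public

restrict : ∀ {w} {xs ys : List (Subset n)} → Free w xs → Unique ys → (∀ {f} → f ∈ ys → f ∈ xs) → Free w ys
restrict F ys! ys⊆xs = record
  { unique = ys!
  ; uniform = uniform F ∘ ys⊆xs
  ; free = λ C zs len zs∈ → free F C zs len (All.map ys⊆xs zs∈)
  }

select-free : ∀ {w} {xs : List (Subset n)} P → Free w xs → Free w (select P xs)
select-free {xs = xs} P F = restrict F (Unique.filter⁺ _ (unique F)) (proj₁ ∘ ∈-select⁻ P xs)

∈-take⁻ : ∀ {A : Set} k (xs : List A) {x} → x ∈ take k xs → x ∈ xs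
∈-take⁻ (suc k) (x ∷ xs) (here p) = here p
∈-take⁻ (suc k) (x ∷ xs) (there p) = there (∈-take⁻ k xs p)

take-free : ∀ {w} {xs : List (Subset n)} k → Free w xs → Free w (take k xs)
take-free {xs = xs} k F = restrict F (Unique.take⁺ k (unique F)) (∈-take⁻ k xs)

length-take-≤ : ∀ {A : Set} k (xs : List A) → k ≤ length xs → length (take k xs) ≡ k
length-take-≤ k xs k≤ = trans (length-take k xs) (m≤n⇒m⊓n≡m k≤)

link : Fin n → List (Subset n) → List (Subset n)
link v xs = map (flip v) (select (λ f → lookup f v) xs)

∈-link⁻ : ∀ v (xs : List (Subset n)) {g} → g ∈ link v xs → ∃[ f ] f ∈ xs × f ∋ v × g ≡ flip v f
∈-link⁻ v xs g∈ = let f , f∈ , g≡ = ∈-map⁻ (flip v) g∈ ; f∈xs , fv = ∈-select⁻ (λ f → lookup f v) xs f∈ in f , f∈xs , fv , g≡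

-- Putting `v` back into the members of a sunflower of the link puts it into the core as well, so
-- the core becomes `flip v C`.
link-free : ∀ {w} {xs : List (Subset n)} v → Free (suc w) xs → Free w (link v xs)
link-free {w = w} {xs} v F = record
  { unique = Unique.map⁺ (flip-injective v) (Unique.filter⁺ _ (unique F))
  ; uniform = uni
  ; free = λ C ys len ys∈ ys! sun → free F (flip v C) (map (flip v) ys) (trans (length-map (flip v) ys) len)
      (All.map⁺ (All.map (proj₁ ∘ back) ys∈)) (Unique.map⁺ (flip-injective v) ys!)
      (AllPairs.map⁺ (core ys∈ sun))
  }
  where
  uni : ∀ {g} → g ∈ link v xs → ∣ g ∣ ≡ w
  uni g∈ with ∈-link⁻ v xs g∈
  ... | f , f∈ , fv , refl = suc-injective (trans (∣flip∣ v f fv) (uniform F f∈))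
  back : ∀ {g} → g ∈ link v xs → flip v g ∈ xs × flip v g ∋ v
  back g∈ with ∈-link⁻ v xs g∈
  ... | f , f∈ , fv , refl rewrite flip-involutive v f = f∈ , fv
  core₁ : ∀ {C f g} → f ∈ link v xs → g ∈ link v xs → f ∩ g ≡ C → flip v f ∩ flip v g ≡ flip v C
  core₁ {C} {f} {g} f∈ g∈ eq = flip-injective v (begin
    flip v (flip v f ∩ flip v g)            ≡⟨ flip-∩ v (flip v f) (flip v g) (proj₂ (back f∈)) (proj₂ (back g∈)) ⟨
    flip v (flip v f) ∩ flip v (flip v g)   ≡⟨ cong₂ _∩_ (flip-involutive v f) (flip-involutive v g) ⟩
    f ∩ g                                   ≡⟨ eq ⟩
    C                                       ≡⟨ flip-involutive v C ⟨
    flip v (flip v C)                       ∎)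
    where open ≡-Reasoning
  core : ∀ {C ys} → All (_∈ link v xs) ys → AllPairs (λ f g → f ∩ g ≡ C) ys → AllPairs (λ f g → flip v f ∩ flip v g ≡ flip v C) ys
  core [] [] = []
  core (y∈ ∷ ys∈) (p ∷ ps) = All.zipWith (λ (z∈ , eq) → core₁ y∈ z∈ eq) (ys∈ , p) ∷ core ys∈ ps

∑-link : ∀ v (xs : List (Subset n)) h → ∑ (link v xs) h ≡ ∑ xs (λ f → ⟦ lookup f v ⟧ * h (flip v f))
∑-link v xs h = trans (∑-map (flip v) (select (λ f → lookup f v) xs) h) (∑-select (λ f → lookup f v) xs (h ∘ flip v))

deg : List (Subset n) → Fin n → ℕ
deg xs u = # xs (λ f → lookup f u)

deg₂ : List (Subset n) → Fin n → Fin n → ℕ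
deg₂ xs u v = # xs (λ f → lookup f u ∧ lookup f v)

deg₃ : List (Subset n) → Fin n → Fin n → Fin n → ℕ
deg₃ xs u v w = # xs (λ f → lookup f u ∧ (lookup f v ∧ lookup f w))

length-link : ∀ v (xs : List (Subset n)) → length (link v xs) ≡ deg xs v
length-link v xs = trans (length-map (flip v) (select (λ f → lookup f v) xs)) (length-select (λ f → lookup f v) xs)

#-link : ∀ v (xs : List (Subset n)) {P Q : Subset n → Bool} → (∀ f → P (flip v f) ≡ Q f) →
         # (link v xs) P ≡ # xs (λ f → lookup f v ∧ Q f)
#-link v xs {P} {Q} P≡Q = trans (∑-link v xs (λ f → ⟦ P f ⟧)) (∑-cong xs {h = λ f → ⟦ lookup f v ∧ Q f ⟧} λ {f} _ →
  trans (cong (λ b → ⟦ lookup f v ⟧ * ⟦ b ⟧) (P≡Q f)) (sym (⟦∧⟧ (lookup f v) (Q f))))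

free₀ : {xs : List (Subset n)} → Free 0 xs → length xs ≤ 1
free₀ {xs = []} F = z≤n
free₀ {xs = _ ∷ []} F = ≤-refl
free₀ {xs = f ∷ g ∷ _} F with unique F
... | (f≢g ∷ _) ∷ _ = ⊥-elim (f≢g (trans (∣∣≡0 f (uniform F (here refl))) (sym (∣∣≡0 g (uniform F (there (here refl)))))))

singletons-disjoint : ∀ {f g : Subset n} → ∣ f ∣ ≡ 1 → ∣ g ∣ ≡ 1 → f ≢ g → touch f g ≡ false
singletons-disjoint {f = f} {g} hf hg f≢g = ≢true λ t → let v , fv , gv = touch⁻ f g t in
  f≢g (flip-injective v (trans (∣∣≡0 _ (suc-injective (trans (∣flip∣ v f fv) hf)))
                               (sym (∣∣≡0 _ (suc-injective (trans (∣flip∣ v g gv) hg))))))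

-- Four distinct singletons are a sunflower with empty core. The degree and codegree bounds below
-- all reduce to this or to `free₀` by taking links.
free₁ : {xs : List (Subset n)} → Free 1 xs → length xs ≤ 3
free₁ {xs = xs} F = ≮⇒≥ λ 4≤ → let G = take-free 4 F in
  free G ⊥ (take 4 xs) (length-take-≤ 4 xs 4≤) (All.tabulate id) (unique G) (disjoint (unique G) (uniform G))
  where
  disjoint : ∀ {ys} → Unique ys → (∀ {f} → f ∈ ys → ∣ f ∣ ≡ 1) → AllPairs (λ f g → f ∩ g ≡ ⊥) ys
  disjoint [] _ = []
  disjoint {f ∷ ys} (p ∷ ps) u =
    All.tabulate (λ {g} g∈ → touch-false⇒∩≡⊥ f g (singletons-disjoint (u (here refl)) (u (there g∈)) (All.lookup p g∈)))
    ∷ disjoint ps (u ∘ there)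

deg-link : ∀ (xs : List (Subset n)) {u v} → u ≢ v → deg (link u xs) v ≡ deg₂ xs u v
deg-link xs {u} {v} u≢v = #-link u xs {λ f → lookup f v} (λ f → lookup-flip-≢ f (u≢v ∘ sym))

deg₂-link : ∀ (xs : List (Subset n)) {u v w} → u ≢ v → u ≢ w → deg₂ (link u xs) v w ≡ deg₃ xs u v w
deg₂-link xs {u} {v} {w} u≢v u≢w = #-link u xs {λ f → lookup f v ∧ lookup f w}
  (λ f → cong₂ _∧_ (lookup-flip-≢ f (u≢v ∘ sym)) (lookup-flip-≢ f (u≢w ∘ sym)))

module _ {xs : List (Subset n)} where

  deg≤3 : Free 2 xs → ∀ u → deg xs u ≤ 3
  deg≤3 F u = subst (_≤ 3) (length-link u xs) (free₁ (link-free u F))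

  deg≤1 : Free 1 xs → ∀ u → deg xs u ≤ 1
  deg≤1 F u = subst (_≤ 1) (length-link u xs) (free₀ (link-free u F))

module _ {xs : List (Subset n)} where

  deg₂≤1 : Free 2 xs → ∀ {u v} → u ≢ v → deg₂ xs u v ≤ 1
  deg₂≤1 F {u} {v} u≢v = subst (_≤ 1) (deg-link xs u≢v) (deg≤1 (link-free u F) v)

  deg₂≤3 : Free 3 xs → ∀ {u v} → u ≢ v → deg₂ xs u v ≤ 3
  deg₂≤3 F {u} {v} u≢v = subst (_≤ 3) (deg-link xs u≢v) (deg≤3 (link-free u F) v)

deg₃≤1 : ∀ {xs : List (Subset n)} → Free 3 xs → ∀ {u v w} → u ≢ v → u ≢ w → v ≢ w → deg₃ xs u v w ≤ 1
deg₃≤1 {xs = xs} F {u} u≢v u≢w v≢w = subst (_≤ 1) (deg₂-link xs u≢v u≢w) (deg₂≤1 (link-free u F) v≢w)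

touch-self : ∀ {w} (f : Subset n) → ∣ f ∣ ≡ suc w → touch f f ≡ true
touch-self f h = let v , fv = ∣∣≡suc f h in touch⁺ f f v fv fv

-- The core is empty. Distinctness comes for free because a nonempty set touches itself, hence the
-- size `suc w`.
no-4-disjoint : ∀ {w} {xs : List (Subset n)} → Free (suc w) xs → ∀ ys → length ys ≡ 4 → All (_∈ xs) ys →
                ¬ AllPairs (λ f g → touch f g ≡ false) ys
no-4-disjoint {w = w} {xs} F ys len ys∈ dis = free F ⊥ ys len ys∈ (unrepeated ys∈ dis) (AllPairs.map (λ {f} {g} → touch-false⇒∩≡⊥ f g) dis)
  where
  unrepeated : ∀ {ys} → All (_∈ xs) ys → AllPairs (λ f g → touch f g ≡ false) ys → Unique ys
  unrepeated [] [] = []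
  unrepeated {f ∷ _} (f∈ ∷ ys∈) (p ∷ ps) =
    All.map (λ h f≡g → false≢true h (subst (λ g → touch f g ≡ true) f≡g (touch-self f (uniform F f∈)))) p ∷ unrepeated ys∈ ps

-- Graphs: 2-uniform families

record Edge {n} (f : Subset n) (u v : Fin n) : Set where
  field
    apart : u ≢ v
    left     : f ∋ u
    right    : f ∋ v
    edge-only     : ∀ {w} → f ∋ w → w ≡ u ⊎ w ≡ v
    edge-sum      : ∀ (h : Fin n → ℕ) → ∑ᶠ (λ w → ⟦ lookup f w ⟧ * h w) ≡ h u + h v

  outside : ∀ {w} → w ≢ u → w ≢ v → f ∌ w
  outside w≢u w≢v = ≢true λ fw → [ w≢u , w≢v ]′ (edge-only fw)

open Edge

edge-at : ∀ (f : Subset n) {u} → ∣ f ∣ ≡ 2 → f ∋ u → ∃[ v ] Edge f u v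
edge-at f {u} h fu with elements 1 (flip u f) (suc-injective (trans (∣flip∣ u f fu) h))
... | v ∷ [] , refl , E = v , record
  { apart = v≢u ∘ sym
  ; left = fu
  ; right = trans (sym (lookup-flip-≢ f v≢u)) (All.head (Elements.elements-∋ E))
  ; edge-only = only′
  ; edge-sum = λ h → trans (∑ᶠ-flip u f h fu) (cong (h u +_) (trans (Elements.sum E h) (+-identityʳ (h v))))
  }
  where
  v≢u : v ≢ u
  v≢u = ∋-∌⇒≢ (flip u f) (All.head (Elements.elements-∋ E)) (flip-∌ u f fu)
  only′ : ∀ {w} → f ∋ w → w ≡ u ⊎ w ≡ v
  only′ {w} fw with w Fin.≟ u
  ... | yes w≡u = inj₁ w≡u
  ... | no w≢u with Elements.complete E (trans (lookup-flip-≢ f w≢u) fw)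
  ...   | here w≡v = inj₂ w≡v

edge : ∀ (f : Subset n) → ∣ f ∣ ≡ 2 → ∃[ u ] ∃[ v ] Edge f u v
edge f h = let u , fu = ∣∣≡suc f h in u , edge-at f h fu

edge-swap : ∀ {f : Subset n} {u v} → Edge f u v → Edge f v u
edge-swap {u = u} {v} e = record
  { apart = apart e ∘ sym ; left = right e ; right = left e
  ; edge-only = [ inj₂ , inj₁ ]′ ∘ edge-only e ; edge-sum = λ h → trans (edge-sum e h) (+-comm (h u) (h v)) }

touch-edge : ∀ {f : Subset n} {u v} → Edge f u v → ∀ g → touch f g ≡ lookup g u ∨ lookup g v
touch-edge {f = f} {u} {v} e g with touch f g in eq
... | true with touch⁻ f g eq
...   | w , fw , gw with edge-only e fw
...     | inj₁ refl rewrite gw = refl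
...     | inj₂ refl rewrite gw = sym (Bool.∨-zeroʳ (lookup g u))
touch-edge {f = f} {u} {v} e g | false
  rewrite touch-false⁻ f g eq u (left e) | touch-false⁻ f g eq v (right e) = refl

touch-edge⁻ : ∀ {f : Subset n} {u v} → Edge f u v → ∀ g → touch f g ≡ true → g ∋ u ⊎ g ∋ v
touch-edge⁻ {f = f} e g t with touch⁻ f g t
... | w , fw , gw with edge-only e fw
...   | inj₁ refl = inj₁ gw
...   | inj₂ refl = inj₂ gw

τ : List (Subset n) → Subset n → ℕ
τ xs f = # xs (touch f)

-- The pairs are ordered, and each nonempty member is also paired with itself.
touching-pairs : List (Subset n) → ℕ
touching-pairs xs = ∑ xs (τ xs)

away : Subset n → List (Subset n) → List (Subset n)
away f xs = select (miss f) xs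

τ+away : ∀ (xs : List (Subset n)) f → τ xs f + length (away f xs) ≡ length xs
τ+away xs f = trans (cong (τ xs f +_) (length-select (miss f) xs)) (sym (length-split xs (touch f)))

∈-away⁻ : ∀ f (xs : List (Subset n)) {g} → g ∈ away f xs → g ∈ xs × touch f g ≡ false
∈-away⁻ f xs g∈ = let g∈xs , m = ∈-select⁻ (miss f) xs g∈ in g∈xs , not-true m

-- Inclusion-exclusion over the two ends: `f` is the only edge containing both, which gives the 1.
τ-deg : ∀ {xs : List (Subset n)} {f u v} → Free 2 xs → f ∈ xs → Edge f u v → τ xs f + 1 ≡ deg xs u + deg xs v
τ-deg {xs = xs} {f} {u} {v} F f∈ e = begin
  τ xs f + 1                                                        ≡⟨ cong (τ xs f +_) (≤-antisym (deg₂≤1 F (apart e)) (#-∈ f∈ (true-∧ (left e) (right e)))) ⟨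
  τ xs f + deg₂ xs u v                                              ≡⟨ ∑-+ xs _ _ ⟨
  ∑ xs (λ g → ⟦ touch f g ⟧ + ⟦ lookup g u ∧ lookup g v ⟧)          ≡⟨ ∑-cong xs (λ {g} _ → pointwise g) ⟩
  ∑ xs (λ g → ⟦ lookup g u ⟧ + ⟦ lookup g v ⟧)                      ≡⟨ ∑-+ xs _ _ ⟩
  deg xs u + deg xs v                                               ∎
  where
  open ≡-Reasoning
  inclusion-exclusion : ∀ a b → ⟦ a ∨ b ⟧ + ⟦ a ∧ b ⟧ ≡ ⟦ a ⟧ + ⟦ b ⟧
  inclusion-exclusion true true = refl
  inclusion-exclusion true false = refl
  inclusion-exclusion false b = +-identityʳ ⟦ b ⟧
  pointwise : ∀ g → ⟦ touch f g ⟧ + ⟦ lookup g u ∧ lookup g v ⟧ ≡ ⟦ lookup g u ⟧ + ⟦ lookup g v ⟧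
  pointwise g rewrite touch-edge e g = inclusion-exclusion (lookup g u) (lookup g v)

handshake : ∀ (xs : List (Subset n)) (h : Fin n → ℕ) →
            ∑ᶠ (λ u → deg xs u * h u) ≡ ∑ xs (λ f → ∑ᶠ (λ u → ⟦ lookup f u ⟧ * h u))
handshake xs h = trans (∑ᶠ-cong λ u → trans (*-comm (deg xs u) (h u)) (trans (sym (∑-* xs (h u) _)) (∑-cong xs λ {f} _ → *-comm (h u) ⟦ lookup f u ⟧)))
                       (∑ᶠ-swap xs (λ u f → ⟦ lookup f u ⟧ * h u))

∑deg : ∀ {xs : List (Subset n)} → Free 2 xs → ∑ᶠ (deg xs) ≡ length xs * 2
∑deg {xs = xs} F = begin
  ∑ᶠ (deg xs)                                          ≡⟨ ∑ᶠ-cong (λ u → *-identityʳ (deg xs u)) ⟨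
  ∑ᶠ (λ u → deg xs u * 1)                              ≡⟨ handshake xs (λ _ → 1) ⟩
  ∑ xs (λ f → ∑ᶠ (λ u → ⟦ lookup f u ⟧ * 1))           ≡⟨ ∑-cong xs (λ {f} f∈ → let _ , _ , e = edge f (uniform F f∈) in edge-sum e (λ _ → 1)) ⟩
  ∑ xs (λ _ → 2)                                       ≡⟨ ∑-const xs 2 ⟩
  length xs * 2                                        ∎
  where open ≡-Reasoning

∑deg² : ∀ {xs : List (Subset n)} → Free 2 xs → ∑ᶠ (λ u → deg xs u * deg xs u) ≡ touching-pairs xs + length xs
∑deg² {xs = xs} F = begin
  ∑ᶠ (λ u → deg xs u * deg xs u)                       ≡⟨ handshake xs (deg xs) ⟩
  ∑ xs (λ f → ∑ᶠ (λ u → ⟦ lookup f u ⟧ * deg xs u))    ≡⟨ ∑-cong xs (λ {f} f∈ → let _ , _ , e = edge f (uniform F f∈) in trans (edge-sum e (deg xs)) (sym (τ-deg F f∈ e))) ⟩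
  ∑ xs (λ f → τ xs f + 1)                              ≡⟨ ∑-+ xs _ _ ⟩
  touching-pairs xs + ∑ xs (λ _ → 1)                   ≡⟨ cong (touching-pairs xs +_) (length-∑ xs) ⟩
  touching-pairs xs + length xs                        ∎
  where open ≡-Reasoning

-- Such a graph is a star or a triangle. If neither `u` nor `v` lies on all edges, an edge `g`
-- avoiding `u` and an edge `h` avoiding `v` meet in a third vertex `w`, and every edge contains two
-- of `u`, `v`, `w`.
intersecting-graph : ∀ {xs : List (Subset n)} → Free 2 xs → (∀ {f g} → f ∈ xs → g ∈ xs → touch f g ≡ true) → length xs ≤ 3
intersecting-graph {xs = []} F t = z≤n
intersecting-graph {xs = xs@(f ∷ _)} F t with edge f (uniform F (here refl))
... | u , v , e with search xs (λ g → not (lookup g u)) | search xs (λ g → not (lookup g v))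
...   | inj₂ all-u | _ = subst (_≤ 3) (#-all xs _ (λ g∈ → Bool.not-injective (all-u g∈))) (deg≤3 F u)
...   | inj₁ _ | inj₂ all-v = subst (_≤ 3) (#-all xs _ (λ g∈ → Bool.not-injective (all-v g∈))) (deg≤3 F v)
...   | inj₁ (g , g∈ , gu) | inj₁ (h , h∈ , hv)
  with [ (λ p → ⊥-elim (false≢true (not-true gu) p)) , id ]′ (touch-edge⁻ e g (t (here refl) g∈))
     | [ id , (λ p → ⊥-elim (false≢true (not-true hv) p)) ]′ (touch-edge⁻ e h (t (here refl) h∈))
... | gv | hu with edge-at g (uniform F g∈) gv | edge-at h (uniform F h∈) hu
... | w , eg | w′ , eh with touch-edge⁻ eg h (t g∈ h∈)
... | inj₁ p = ⊥-elim (false≢true (not-true hv) p)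
... | inj₂ hw with edge-only eh hw
... | inj₁ refl = ⊥-elim (false≢true (not-true gu) (right eg))
... | inj₂ refl = begin
  length xs                                        ≡⟨ #-all xs (λ _ → true) (λ _ → refl) ⟨
  # xs (λ _ → true)                                ≤⟨ #-cover xs _ (both u v ∷ both u w ∷ both v w ∷ []) (λ k∈ _ → cover k∈) ⟩
  deg₂ xs u v + (deg₂ xs u w + (deg₂ xs v w + 0))  ≤⟨ +-mono-≤ (deg₂≤1 F (apart e)) (+-mono-≤ (deg₂≤1 F (apart eh)) (+-monoˡ-≤ 0 (deg₂≤1 F (apart eg)))) ⟩
  3                                                ∎
  where
  open ≤-Reasoning
  both : Fin _ → Fin _ → Subset _ → Bool
  both a b k = lookup k a ∧ lookup k b
  cover : ∀ {k} → k ∈ xs → Any (λ Q → Q k ≡ true) (both u v ∷ both u w ∷ both v w ∷ [])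
  cover {k} k∈ with touch-edge⁻ e k (t (here refl) k∈) | touch-edge⁻ eg k (t g∈ k∈) | touch-edge⁻ eh k (t h∈ k∈)
  ... | inj₁ ku | inj₁ kv | _ = here (true-∧ ku kv)
  ... | inj₁ ku | inj₂ kw | _ = there (here (true-∧ ku kw))
  ... | inj₂ kv | _ | inj₁ ku = here (true-∧ ku kv)
  ... | inj₂ kv | _ | inj₂ kw = there (there (here (true-∧ kv kw)))

-- By `τ-deg`, the degree of one end of an edge `f` is `τ xs f + 1` minus the degree of the other
-- end, which is at most 3.
deg-lower : ∀ {xs : List (Subset n)} {c} → Free 2 xs → (∀ {f} → f ∈ xs → c ≤ τ xs f) →
            ∀ u → deg xs u ≡ 0 ⊎ c ≤ deg xs u + 2
deg-lower {xs = xs} F c≤τ u with search xs (λ f → lookup f u)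
... | inj₂ none = inj₁ (#-none xs _ none)
... | inj₁ (f , f∈ , fu) with edge-at f (uniform F f∈) fu
... | v , e = inj₂ (linear (+-mono-≤ (c≤τ f∈) (deg≤3 F v)) (lemma _ (τ xs f) (deg xs u) (deg xs v) (τ-deg F f∈ e)))
  where
  lemma : ∀ c t a b → t + 1 ≡ a + b → c + (t + 3) ≡ a + 2 + (c + b)
  lemma c t a b eq = trans (l₁ c t) (trans (cong (λ x → x + 2 + c) eq) (l₂ c a b))
    where
    l₁ : ∀ c t → c + (t + 3) ≡ (t + 1) + 2 + c
    l₁ = solve-∀
    l₂ : ∀ c a b → (a + b) + 2 + c ≡ a + 2 + (c + b)
    l₂ = solve-∀

∑ᶠ-∣ : ∀ {m} (h : Fin n → ℕ) → (∀ u → m ∣ h u) → m ∣ ∑ᶠ h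
∑ᶠ-∣ {zero} h _ = divides 0 refl
∑ᶠ-∣ {suc n} h d = ∣m∣n⇒∣m+n (d zero) (∑ᶠ-∣ (h ∘ suc) (d ∘ suc))

-- Only the degrees 0 and 3 survive `deg-lower`, so 3 divides the degree sum. This excludes 8 edges
-- in `thin-graph` and part of the case of 11 edges.
regular-∣ : ∀ {xs : List (Subset n)} → Free 2 xs → (∀ {f} → f ∈ xs → 5 ≤ τ xs f) → 3 ∣ length xs * 2
regular-∣ {xs = xs} F 5≤τ = subst (3 ∣_) (∑deg F) (∑ᶠ-∣ (deg xs) multiple)
  where
  multiple : ∀ u → 3 ∣ deg xs u
  multiple u with deg-lower F 5≤τ u
  ... | inj₁ eq = subst (3 ∣_) (sym eq) (divides 0 refl)
  ... | inj₂ 5≤ = subst (3 ∣_) (≤-antisym (+-cancelʳ-≤ 2 3 _ 5≤) (deg≤3 F u)) (divides 1 refl)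

-- d² ≡ 5 d modulo 6 for the degrees 0, 2 and 3.
∑deg²-mod6 : ∀ {xs : List (Subset n)} → Free 2 xs → (∀ {f} → f ∈ xs → 4 ≤ τ xs f) →
             ∃[ k ] touching-pairs xs + 6 * k ≡ 9 * length xs
∑deg²-mod6 {n} {xs} F 4≤τ =
  let k , eq = go (deg xs) (λ u → deg≤3 F u) (deg-lower F 4≤τ)
  in k , +-cancelʳ-≡ (length xs) _ _ (begin
    touching-pairs xs + 6 * k + length xs    ≡⟨ l₁ (touching-pairs xs) (6 * k) (length xs) ⟩
    touching-pairs xs + length xs + 6 * k    ≡⟨ cong (_+ 6 * k) (∑deg² F) ⟨
    ∑ᶠ (λ u → deg xs u * deg xs u) + 6 * k   ≡⟨ eq ⟩
    5 * ∑ᶠ (deg xs)                          ≡⟨ cong (5 *_) (∑deg F) ⟩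
    5 * (length xs * 2)                      ≡⟨ l₂ (length xs) ⟩
    9 * length xs + length xs                ∎)
  where
  open ≡-Reasoning
  l₁ : ∀ a b c → a + b + c ≡ a + c + b
  l₁ = solve-∀
  l₂ : ∀ a → 5 * (a * 2) ≡ 9 * a + a
  l₂ = solve-∀
  one : ∀ d → d ≤ 3 → d ≡ 0 ⊎ 4 ≤ d + 2 → ∃[ k ] d * d + 6 * k ≡ 5 * d
  one zero _ _ = 0 , refl
  one 1 _ (inj₂ (s≤s (s≤s (s≤s ()))))
  one 2 _ _ = 1 , refl
  one 3 _ _ = 1 , refl
  one (suc (suc (suc (suc d)))) (s≤s (s≤s (s≤s ()))) _
  go : ∀ {n} (h : Fin n → ℕ) → (∀ u → h u ≤ 3) → (∀ u → h u ≡ 0 ⊎ 4 ≤ h u + 2) →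
       ∃[ k ] ∑ᶠ (λ u → h u * h u) + 6 * k ≡ 5 * ∑ᶠ h
  go {zero} h _ _ = 0 , refl
  go {suc n} h h≤ h≥ with one (h zero) (h≤ zero) (h≥ zero) | go (h ∘ suc) (h≤ ∘ suc) (h≥ ∘ suc)
  ... | k , p | k′ , q = k + k′ , (begin
    h zero * h zero + ∑ᶠ (λ u → h (suc u) * h (suc u)) + 6 * (k + k′)        ≡⟨ l₃ (h zero * h zero) (∑ᶠ (λ u → h (suc u) * h (suc u))) k k′ ⟩
    (h zero * h zero + 6 * k) + (∑ᶠ (λ u → h (suc u) * h (suc u)) + 6 * k′)  ≡⟨ cong₂ _+_ p q ⟩
    5 * h zero + 5 * ∑ᶠ (h ∘ suc)                                            ≡⟨ *-distribˡ-+ 5 (h zero) (∑ᶠ (h ∘ suc)) ⟨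
    5 * (h zero + ∑ᶠ (h ∘ suc))                                              ∎)
    where
    l₃ : ∀ a b k k′ → a + b + 6 * (k + k′) ≡ (a + 6 * k) + (b + 6 * k′)
    l₃ = solve-∀

-- Graphs without three disjoint edges, and the bound of 10 edges in general

Thin : List (Subset n) → Set
Thin xs = ∀ {f g h} → f ∈ xs → g ∈ xs → h ∈ xs → touch f g ≡ false → touch f h ≡ false → touch g h ≡ false → Empty

away-thin : ∀ {xs : List (Subset n)} {f} → Free 2 xs → f ∈ xs → Thin (away f xs)
away-thin {xs = xs} {f} F f∈ {g} {h} {k} g∈ h∈ k∈ gh gk hk =
  let g∈′ , fg = ∈-away⁻ f xs g∈ ; h∈′ , fh = ∈-away⁻ f xs h∈ ; k∈′ , fk = ∈-away⁻ f xs k∈ in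
  no-4-disjoint F (f ∷ g ∷ h ∷ k ∷ []) refl (f∈ ∷ g∈′ ∷ h∈′ ∷ k∈′ ∷ [])
    ((fg ∷ fh ∷ fk ∷ []) ∷ (gh ∷ gk ∷ []) ∷ (hk ∷ []) ∷ [] ∷ [])

-- The edges disjoint from `f` touch pairwise, since two disjoint ones would make three disjoint
-- edges with `f`.
thin-away : ∀ {xs : List (Subset n)} {f} → Free 2 xs → Thin xs → f ∈ xs → length (away f xs) ≤ 3
thin-away {xs = xs} {f} F thin f∈ = intersecting-graph (select-free (miss f) F) λ {g} {h} g∈ h∈ →
  let g∈′ , fg = ∈-away⁻ f xs g∈ ; h∈′ , fh = ∈-away⁻ f xs h∈ in
  [ id , (λ gh → ⊥-elim (thin f∈ g∈′ h∈′ fg fh gh)) ]′ (true? (touch g h))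

away-bound : ∀ (xs : List (Subset n)) f {a b} → length xs ≡ a + b → length (away f xs) ≤ b → a ≤ τ xs f
away-bound xs f {a} {b} len ≤b = +-cancelʳ-≤ b a (τ xs f) (begin
  a + b                            ≡⟨ len ⟨
  length xs                        ≡⟨ τ+away xs f ⟨
  τ xs f + length (away f xs)      ≤⟨ +-monoʳ-≤ (τ xs f) ≤b ⟩
  τ xs f + b                       ∎)
  where open ≤-Reasoning

-- Among 8 edges, each misses at most 3 and so touches at least 5, itself included; but 3 does not
-- divide the degree sum 16.
thin-graph : ∀ {xs : List (Subset n)} → Free 2 xs → Thin xs → length xs ≤ 7
thin-graph {xs = xs} F thin = ≮⇒≥ λ 8≤ →
  let ys = take 8 xs
      G = take-free 8 F
      len = length-take-≤ 8 xs 8≤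
      thin-ys : Thin ys
      thin-ys f∈ g∈ h∈ = thin (∈-take⁻ 8 xs f∈) (∈-take⁻ 8 xs g∈) (∈-take⁻ 8 xs h∈)
      5≤τ : ∀ {f} → f ∈ ys → 5 ≤ τ ys f
      5≤τ {f} f∈ = away-bound ys f {5} {3} len (thin-away G thin-ys f∈)
  in from-no (3 ∣? 16) (subst (λ l → 3 ∣ l * 2) len (regular-∣ G 5≤τ))

-- Every edge touches at least 4, giving 28 pairs. The number of pairs is congruent to 63 modulo 6,
-- and 33 is the least such number from 28 on.
thin-graph-7 : ∀ {xs : List (Subset n)} → Free 2 xs → Thin xs → length xs ≡ 7 → 33 ≤ touching-pairs xs
thin-graph-7 {xs = xs} F thin len = conclude (∑deg²-mod6 F 4≤τ)
  where
  4≤τ : ∀ {f} → f ∈ xs → 4 ≤ τ xs f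
  4≤τ {f} f∈ = away-bound xs f {4} {3} len (thin-away F thin f∈)
  28≤ : 28 ≤ touching-pairs xs
  28≤ = subst (λ l → l * 4 ≤ touching-pairs xs) len (∑-≥const xs 4 4≤τ)
  conclude : (∃[ k ] touching-pairs xs + 6 * k ≡ 9 * length xs) → 33 ≤ touching-pairs xs
  conclude (k , eq) rewrite len with k ≤? 5
  ... | yes k≤5 = +-cancelʳ-≤ (6 * k) 33 _ (≤-trans (+-monoʳ-≤ 33 (*-monoʳ-≤ 6 k≤5)) (≤-reflexive (sym eq)))
  ... | no k≰5 = ⊥-elim (<⇒≱ (from-yes (63 <? 64)) (≤-trans (+-mono-≤ 28≤ (*-monoʳ-≤ 6 (≰⇒> k≰5))) (≤-reflexive eq)))

deg-away : ∀ (xs : List (Subset n)) f u → deg xs u ≡ deg (away f xs) u + # xs (λ g → lookup g u ∧ touch f g)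
deg-away xs f u = begin
  deg xs u                                                      ≡⟨ #-split xs (λ g → lookup g u) (touch f) ⟩
  # xs (λ g → lookup g u ∧ touch f g) + # xs (λ g → lookup g u ∧ miss f g)  ≡⟨ +-comm (# xs (λ g → lookup g u ∧ touch f g)) _ ⟩
  # xs (λ g → lookup g u ∧ miss f g) + # xs (λ g → lookup g u ∧ touch f g)  ≡⟨ cong (_+ # xs (λ g → lookup g u ∧ touch f g)) swap ⟩
  deg (away f xs) u + # xs (λ g → lookup g u ∧ touch f g)       ∎
  where
  open ≡-Reasoning
  swap : # xs (λ g → lookup g u ∧ miss f g) ≡ deg (away f xs) u
  swap = trans (∑-cong xs (λ {g} _ → cong ⟦_⟧ (Bool.∧-comm (lookup g u) (miss f g)))) (sym (#-select (miss f) (λ g → lookup g u) xs))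

-- d (3 − d) for d ≤ 3, so that in a graph with e edges and maximum degree 3
-- the defects of the degrees sum to 6e − Σ deg².
defect : ℕ → ℕ
defect 1 = 2
defect 2 = 2
defect _ = 0

-- Here 6e = 42 and Σ deg² ≥ 33 + 7. As each vertex of degree 1 or 2 has defect 2, there is at most
-- one of them.
thin-graph-7-defect : ∀ {xs : List (Subset n)} → Free 2 xs → Thin xs → length xs ≡ 7 → ∑ᶠ (defect ∘ deg xs) ≤ 2
thin-graph-7-defect {xs = xs} F thin len = +-cancelʳ-≤ 40 _ 2 (begin
  ∑ᶠ (defect ∘ deg xs) + 40                                  ≤⟨ +-monoʳ-≤ _ (+-monoˡ-≤ 7 (thin-graph-7 F thin len)) ⟩
  ∑ᶠ (defect ∘ deg xs) + (touching-pairs xs + 7)             ≡⟨ cong (λ l → ∑ᶠ (defect ∘ deg xs) + (touching-pairs xs + l)) len ⟨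
  ∑ᶠ (defect ∘ deg xs) + (touching-pairs xs + length xs)     ≡⟨ cong (∑ᶠ (defect ∘ deg xs) +_) (∑deg² F) ⟨
  ∑ᶠ (defect ∘ deg xs) + ∑ᶠ (λ u → deg xs u * deg xs u)      ≡⟨ ∑ᶠ-+ (defect ∘ deg xs) (λ u → deg xs u * deg xs u) ⟨
  ∑ᶠ (λ u → defect (deg xs u) + deg xs u * deg xs u)         ≤⟨ ∑ᶠ-mono (λ u → pointwise (deg xs u) (deg≤3 F u)) ⟩
  ∑ᶠ (λ u → 3 * deg xs u)                                    ≡⟨ ∑ᶠ-* 3 (deg xs) ⟩
  3 * ∑ᶠ (deg xs)                                            ≡⟨ cong (3 *_) (∑deg F) ⟩
  3 * (length xs * 2)                                        ≡⟨ cong (λ l → 3 * (l * 2)) len ⟩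
  42                                                         ∎)
  where
  open ≤-Reasoning
  pointwise : ∀ d → d ≤ 3 → defect d + d * d ≤ 3 * d
  pointwise 0 _ = from-yes (0 ≤? 0)
  pointwise 1 _ = from-yes (3 ≤? 3)
  pointwise 2 _ = from-yes (6 ≤? 6)
  pointwise 3 _ = from-yes (9 ≤? 9)
  pointwise (suc (suc (suc (suc d)))) (s≤s (s≤s (s≤s ())))

-- Removing an edge uv with deg u = 3 and deg v = 2 together with the edges
-- touching it leaves 7 edges, which have a single vertex of degree 1 or 2.
-- But both the other neighbour w of v and a neighbour z ≠ v, w of u become
-- such vertices.
no-graph-11′ : ∀ {xs : List (Subset n)} {f u v} → Free 2 xs → length xs ≡ 11 → (∀ {f} → f ∈ xs → 4 ≤ τ xs f) →
               f ∈ xs → τ xs f ≡ 4 → Edge f u v → deg xs u ≡ 3 → deg xs v ≡ 2 → Empty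
no-graph-11′ {xs = xs} {f} {u} {v} F len 4≤τ f∈ τf e du dv
  with avoid (unique F) (λ g → lookup g v) (f ∷ []) (≤-reflexive (sym dv))
... | g , g∈ , gv , g∉ with edge-at g (uniform F g∈) gv
... | w , eg = conclude (search xs (λ k → lookup k u ∧ (not (lookup k v) ∧ not (lookup k w))))
  where
  open ≤-Reasoning
  R = away f xs
  R-free : Free 2 R
  R-free = select-free (miss f) F
  R-7 : length R ≡ 7
  R-7 = +-cancelˡ-≡ 4 _ 7 (trans (cong (_+ length R) (sym τf)) (trans (τ+away xs f) len))
  w≢v : w ≢ v
  w≢v = apart eg ∘ sym
  w≢u : w ≢ u
  w≢u refl = g∉ (here (#≤1⇒≡ (λ k → lookup k u ∧ lookup k v) (deg₂≤1 F (apart e)) g∈ f∈ (true-∧ (right eg) gv) (true-∧ (left e) (right e))))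
  defect-R : ∀ y → 1 ≤ deg R y → deg R y ≤ 2 → defect (deg R y) ≡ 2
  defect-R y 1≤ ≤2 with deg R y
  ... | 1 = refl
  ... | 2 = refl
  defect-R y () ≤2 | 0
  defect-R y 1≤ (s≤s (s≤s ())) | suc (suc (suc d))
  touching : Fin _ → ℕ
  touching y = # xs (λ k → lookup k y ∧ touch f k)
  touching≤ : ∀ y → touching y ≤ deg₂ xs y u + (deg₂ xs y v + 0)
  touching≤ y = #-cover xs _ ((λ k → lookup k y ∧ lookup k u) ∷ (λ k → lookup k y ∧ lookup k v) ∷ []) λ {k} _ h →
    let ky , t = ∧-true h in [ (λ ku → here (true-∧ ky ku)) , (λ kv → there (here (true-∧ ky kv))) ]′ (touch-edge⁻ e k t)
  -- A vertex that loses at least one edge but not all of them keeps degree 1 or 2.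
  defect-neighbour : ∀ {y} c → touching y ≤ c → suc c ≤ deg xs y → 1 ≤ touching y → defect (deg R y) ≡ 2
  defect-neighbour {y} c t≤c c< 1≤t = defect-R y
    (+-cancelʳ-≤ (touching y) 1 _ (≤-trans (s≤s t≤c) (≤-trans c< (≤-reflexive (deg-away xs f y)))))
    (+-cancelʳ-≤ (touching y) _ 2 (≤-trans (≤-reflexive (sym (deg-away xs f y))) (≤-trans (deg≤3 F y) (+-monoʳ-≤ 2 1≤t))))
  3≤dw : 3 ≤ deg xs w
  3≤dw = +-cancelˡ-≤ 2 3 _ (begin
    4 + 1                    ≤⟨ +-monoˡ-≤ 1 (4≤τ g∈) ⟩
    τ xs g + 1               ≡⟨ τ-deg F g∈ eg ⟩
    deg xs v + deg xs w      ≡⟨ cong (_+ deg xs w) dv ⟩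
    2 + deg xs w             ∎)
  -- Of the at least three edges at `w`, only those to `u` and to `v` can be removed.
  defect-w : defect (deg R w) ≡ 2
  defect-w = defect-neighbour 2 (≤-trans (touching≤ w) (+-mono-≤ (deg₂≤1 F w≢u) (+-monoˡ-≤ 0 (deg₂≤1 F w≢v))))
    3≤dw (#-∈ g∈ (true-∧ (right eg) (touch⁺ f g v (right e) gv)))
  conclude : (∃[ k ] k ∈ xs × lookup k u ∧ (not (lookup k v) ∧ not (lookup k w)) ≡ true) ⊎ (∀ {k} → k ∈ xs → lookup k u ∧ (not (lookup k v) ∧ not (lookup k w)) ≡ false) → Empty
  -- At most two of the three edges at `u` lead to `v` or `w`, so there is a third neighbour.
  conclude (inj₂ none) = <⇒≱ (≤-refl {3}) (begin
    3                                      ≡⟨ du ⟨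
    deg xs u                               ≤⟨ #-cover xs _ ((λ k → lookup k u ∧ lookup k v) ∷ (λ k → lookup k u ∧ lookup k w) ∷ []) cover ⟩
    deg₂ xs u v + (deg₂ xs u w + 0)        ≤⟨ +-mono-≤ (deg₂≤1 F (apart e)) (+-monoˡ-≤ 0 (deg₂≤1 F (w≢u ∘ sym))) ⟩
    2                                      ∎)
    where
    cover : ∀ {k} → k ∈ xs → k ∋ u → Any (λ Q → Q k ≡ true) ((λ k → lookup k u ∧ lookup k v) ∷ (λ k → lookup k u ∧ lookup k w) ∷ [])
    cover {k} k∈ ku with lookup k v in kv | lookup k w in kw | none k∈
    ... | true | _ | _ = here (true-∧ ku kv)
    ... | false | true | _ = there (here (true-∧ ku kw))
    ... | false | false | h = ⊥-elim (false≢true h (true-∧ ku refl))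
  conclude (inj₁ (k , k∈ , h)) with ∧-true h
  ... | ku , h′ with ∧-true h′
  ... | kv , kw with edge-at k (uniform F k∈) ku
  ... | z , ek = <⇒≱ (from-yes (2 <? 4)) (begin
    4                                        ≡⟨ cong₂ _+_ defect-w defect-z ⟨
    defect (deg R w) + defect (deg R z)      ≤⟨ ∑ᶠ-∈₂ (defect ∘ deg R) (z≢w ∘ sym) ⟩
    ∑ᶠ (defect ∘ deg R)                      ≤⟨ thin-graph-7-defect R-free (away-thin F f∈) R-7 ⟩
    2                                        ∎)
    where
    z≢u : z ≢ u
    z≢u = apart ek ∘ sym
    z≢v : z ≢ v
    z≢v = ∋-∌⇒≢ k (right ek) (not-true kv)
    z≢w : z ≢ w
    z≢w = ∋-∌⇒≢ k (right ek) (not-true kw)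
    2≤dz : 2 ≤ deg xs z
    2≤dz = +-cancelˡ-≤ 3 2 _ (begin
      4 + 1                    ≤⟨ +-monoˡ-≤ 1 (4≤τ k∈) ⟩
      τ xs k + 1               ≡⟨ τ-deg F k∈ ek ⟩
      deg xs u + deg xs z      ≡⟨ cong (_+ deg xs z) du ⟩
      3 + deg xs z             ∎)
    -- f and g are the only edges at v.
    z≁v : deg₂ xs v z ≤ 0
    z≁v = +-cancelʳ-≤ 2 _ 0 (begin
      deg₂ xs v z + 2                                                  ≤⟨ +-monoʳ-≤ (deg₂ xs v z) (#-∈₂ {P = λ k → lookup k v ∧ not (lookup k z)} f∈ g∈ (λ f≡g → g∉ (here (sym f≡g)))
                                                                          (true-∧ (right e) (cong not (outside e z≢u z≢v)))
                                                                          (true-∧ gv (cong not (outside eg z≢v z≢w)))) ⟩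
      deg₂ xs v z + # xs (λ k → lookup k v ∧ not (lookup k z))         ≡⟨ #-split xs (λ k → lookup k v) (λ k → lookup k z) ⟨
      deg xs v                                                         ≡⟨ dv ⟩
      2                                                                ∎)
    z≁v′ : deg₂ xs z v ≤ 0
    z≁v′ = ≤-trans (#-mono xs (λ {k} _ h → let zk , vk = ∧-true {lookup k z} h in true-∧ vk zk)) z≁v
    defect-z : defect (deg R z) ≡ 2
    defect-z = defect-neighbour 1 (≤-trans (touching≤ z) (+-mono-≤ (deg₂≤1 F z≢u) (+-monoˡ-≤ 0 z≁v′)))
      2≤dz (#-∈ k∈ (true-∧ (right ek) (touch⁺ f k u (left e) ku)))

some-or-all : ∀ (xs : List (Subset n)) c → (∃[ f ] f ∈ xs × τ xs f ≤ c) ⊎ (∀ {f} → f ∈ xs → suc c ≤ τ xs f)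
some-or-all xs c with search xs (λ f → does (τ xs f ≤? c))
... | inj₂ none = inj₂ λ {f} f∈ → ≰⇒> λ τ≤ → false≢true (none f∈) (dec-true (τ xs f ≤? c) τ≤)
... | inj₁ (f , f∈ , h) = inj₁ (f , f∈ , decidable-stable (τ xs f ≤? c) λ τ≰ → false≢true (dec-false (τ xs f ≤? c) τ≰) h)

-- Every edge misses at most 7, so it touches at least 4. Not all can touch 5, as 3 does not divide
-- 22; an edge touching exactly 4 has end degrees summing to 5, that is 3 and 2.
no-graph-11 : ∀ {xs : List (Subset n)} → Free 2 xs → length xs ≢ 11
no-graph-11 {xs = xs} F len with some-or-all xs 4
... | inj₂ 5≤τ = from-no (3 ∣? 22) (subst (λ l → 3 ∣ l * 2) len (regular-∣ F 5≤τ))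
... | inj₁ (f , f∈ , τ≤) with edge f (uniform F f∈)
... | u , v , e = split (deg xs u) (deg xs v) refl refl (deg≤3 F u) (deg≤3 F v) (trans (sym (τ-deg F f∈ e)) (cong (_+ 1) τf))
  where
  4≤τ : ∀ {f} → f ∈ xs → 4 ≤ τ xs f
  4≤τ {f} f∈ = away-bound xs f {4} {7} len (thin-graph (select-free (miss f) F) (away-thin F f∈))
  τf : τ xs f ≡ 4
  τf = ≤-antisym τ≤ (4≤τ f∈)
  split : ∀ a b → deg xs u ≡ a → deg xs v ≡ b → a ≤ 3 → b ≤ 3 → a + b ≡ 5 → Empty
  split 2 3 du dv _ _ _ = no-graph-11′ F len 4≤τ f∈ τf (edge-swap e) dv du
  split 3 2 du dv _ _ _ = no-graph-11′ F len 4≤τ f∈ τf e du dv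
  split 0 b _ _ _ b≤ refl with s≤s (s≤s (s≤s ())) ← b≤
  split 1 b _ _ _ b≤ refl with s≤s (s≤s (s≤s ())) ← b≤
  split (suc (suc (suc (suc a)))) b _ _ (s≤s (s≤s (s≤s ()))) _ _

graph-10 : ∀ {xs : List (Subset n)} → Free 2 xs → length xs ≤ 10
graph-10 {xs = xs} F = ≮⇒≥ λ 11≤ → no-graph-11 (take-free 11 F) (length-take-≤ 11 xs 11≤)

-- Lower bounds on the touching pairs of a link

∑-split : ∀ {A : Set} (P : A → Bool) (xs : List A) h → ∑ xs h ≡ ∑ (select P xs) h + ∑ (select (not ∘ P) xs) h
∑-split P xs h = begin
  ∑ xs h                                                                ≡⟨ ∑-cong xs (λ {x} _ → pointwise (P x) (h x)) ⟩
  ∑ xs (λ x → ⟦ P x ⟧ * h x + ⟦ not (P x) ⟧ * h x)                      ≡⟨ ∑-+ xs _ _ ⟩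
  ∑ xs (λ x → ⟦ P x ⟧ * h x) + ∑ xs (λ x → ⟦ not (P x) ⟧ * h x)         ≡⟨ cong₂ _+_ (∑-select P xs h) (∑-select (not ∘ P) xs h) ⟨
  ∑ (select P xs) h + ∑ (select (not ∘ P) xs) h                         ∎
  where
  open ≡-Reasoning
  pointwise : ∀ b k → k ≡ ⟦ b ⟧ * k + ⟦ not b ⟧ * k
  pointwise true = solve-∀
  pointwise false = solve-∀

-- The edges touching `f` contribute at least `c` each; the others contribute at least what they
-- touch among themselves.
touching-pairs-away : ∀ (xs : List (Subset n)) f c → (∀ {g} → g ∈ xs → c ≤ τ xs g) →
                      τ xs f * c + touching-pairs (away f xs) ≤ touching-pairs xs
touching-pairs-away xs f c c≤τ = begin
  τ xs f * c + touching-pairs (away f xs)                            ≡⟨ cong (λ l → l * c + touching-pairs (away f xs)) (length-select (touch f) xs) ⟨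
  length (select (touch f) xs) * c + touching-pairs (away f xs)      ≤⟨ +-mono-≤ (∑-≥const (select (touch f) xs) c (λ g∈ → c≤τ (proj₁ (∈-select⁻ (touch f) xs g∈))))
                                                                          (∑-mono (away f xs) (λ {g} _ → fewer g)) ⟩
  ∑ (select (touch f) xs) (τ xs) + ∑ (away f xs) (τ xs)              ≡⟨ ∑-split (touch f) xs (τ xs) ⟨
  touching-pairs xs                                                  ∎
  where
  open ≤-Reasoning
  fewer : ∀ g → τ (away f xs) g ≤ τ xs g
  fewer g = ≤-trans (≤-reflexive (#-select (miss f) (touch g) xs)) (#-mono xs (λ {h} _ p → proj₂ (∧-true {miss f h} p)))

module _ {xs : List (Subset n)} (F : Free 2 xs) where

  private
    away≤7 : ∀ {f} → f ∈ xs → length (away f xs) ≤ 7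
    away≤7 {f} f∈ = thin-graph (select-free (miss f) F) (away-thin F f∈)

    33≤away : ∀ {f} → f ∈ xs → 7 ≤ length (away f xs) → 33 ≤ touching-pairs (away f xs)
    33≤away {f} f∈ 7≤ = thin-graph-7 (select-free (miss f) F) (away-thin F f∈) (≤-antisym (away≤7 f∈) 7≤)

    7≤away : ∀ {f} c → length xs ≡ c + 7 → τ xs f ≤ c → 7 ≤ length (away f xs)
    7≤away {f} c len τ≤ = +-cancelˡ-≤ c 7 _ (begin
      c + 7                         ≡⟨ len ⟨
      length xs                     ≡⟨ τ+away xs f ⟨
      τ xs f + length (away f xs)   ≤⟨ +-monoˡ-≤ _ τ≤ ⟩
      c + length (away f xs)        ∎)
      where open ≤-Reasoning

  -- If some edge touches only 3, removing these 3 leaves a thin graph with 7 edges, and 3 · 3 + 33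
  -- = 42. Otherwise the number of pairs is at least 40 and divisible by 6.
  touching-pairs-10 : length xs ≡ 10 → 42 ≤ touching-pairs xs
  touching-pairs-10 len with some-or-all xs 3
  ... | inj₁ (f , f∈ , τ≤) = begin
    9 + 33                                      ≤⟨ +-mono-≤ (*-monoˡ-≤ 3 (3≤τ f∈)) (33≤away f∈ (7≤away {f} 3 len τ≤)) ⟩
    τ xs f * 3 + touching-pairs (away f xs)     ≤⟨ touching-pairs-away xs f 3 3≤τ ⟩
    touching-pairs xs                           ∎
    where
    open ≤-Reasoning
    3≤τ : ∀ {f} → f ∈ xs → 3 ≤ τ xs f
    3≤τ {f} f∈ = away-bound xs f {3} {7} len (away≤7 {f} f∈)
  ... | inj₂ 4≤τ = conclude (∑deg²-mod6 F 4≤τ)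
    where
    40≤ : 40 ≤ touching-pairs xs
    40≤ = subst (λ l → l * 4 ≤ touching-pairs xs) len (∑-≥const xs 4 4≤τ)
    conclude : (∃[ k ] touching-pairs xs + 6 * k ≡ 9 * length xs) → 42 ≤ touching-pairs xs
    conclude (k , eq) rewrite len with k ≤? 8
    ... | yes k≤8 = +-cancelʳ-≤ (6 * k) 42 _ (≤-trans (+-monoʳ-≤ 42 (*-monoʳ-≤ 6 k≤8)) (≤-reflexive (sym eq)))
    ... | no k≰8 = ⊥-elim (<⇒≱ (from-yes (90 <? 94)) (≤-trans (+-mono-≤ 40≤ (*-monoʳ-≤ 6 (≰⇒> k≰8))) (≤-reflexive eq)))

  -- An edge touching at most 2 leaves a thin graph with 7 edges, whose 33 pairs are already enough.
  touching-pairs-9 : length xs ≡ 9 → 27 ≤ touching-pairs xs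
  touching-pairs-9 len with some-or-all xs 2
  ... | inj₁ (f , f∈ , τ≤) = ≤-trans (from-yes (27 ≤? 33)) (≤-trans (33≤away f∈ (7≤away {f} 2 len τ≤))
      (≤-trans (m≤n+m _ (τ xs f * 0)) (touching-pairs-away xs f 0 (λ _ → z≤n))))
  ... | inj₂ 3≤τ = subst (λ l → l * 3 ≤ touching-pairs xs) len (∑-≥const xs 3 3≤τ)

  -- The squared degree is replaced by a linear term, because the sum of the degrees is known. With
  -- d edges and t pairs, 79 makes d = 10, t = 42 an equality. For d ≤ 8 the trivial t ≥ d suffices,
  -- since 10d ≤ 84.
  touching-pairs-lower : 10 * (length xs * length xs) ≤ 79 * length xs + 5 * touching-pairs xs
  touching-pairs-lower with m≤n⇒m<n∨m≡n (graph-10 F)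
  ... | inj₂ len = subst (λ l → 10 * (l * l) ≤ 79 * l + 5 * touching-pairs xs) (sym len) (+-monoʳ-≤ 790 (*-monoʳ-≤ 5 (touching-pairs-10 len)))
  ... | inj₁ (s≤s ≤9) with m≤n⇒m<n∨m≡n ≤9
  ... | inj₂ len = subst (λ l → 10 * (l * l) ≤ 79 * l + 5 * touching-pairs xs) (sym len)
    (≤-trans (from-yes (810 ≤? 846)) (+-monoʳ-≤ 711 (*-monoʳ-≤ 5 (touching-pairs-9 len))))
  ... | inj₁ (s≤s ≤8) = begin
    10 * (d * d)                          ≡⟨ l₁ d ⟩
    d * (10 * d)                          ≤⟨ *-monoʳ-≤ d (≤-trans (*-monoʳ-≤ 10 ≤8) (from-yes (80 ≤? 84))) ⟩
    d * 84                                ≡⟨ l₂ d ⟩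
    79 * d + 5 * (d * 1)                  ≤⟨ +-monoʳ-≤ (79 * d) (*-monoʳ-≤ 5 (∑-≥const xs 1 (λ {f} f∈ → #-∈ {P = touch f} f∈ (touch-self f (uniform F f∈))))) ⟩
    79 * d + 5 * touching-pairs xs        ∎
    where
    open ≤-Reasoning
    d = length xs
    l₁ : ∀ d → 10 * (d * d) ≡ d * (10 * d)
    l₁ = solve-∀
    l₂ : ∀ d → d * 84 ≡ 79 * d + 5 * (d * 1)
    l₂ = solve-∀

-- Cross-intersecting pairs of graphs

touching-or-disjoint : ∀ (xs : List (Subset n)) → Unique xs →
  (∃[ f ] ∃[ g ] f ∈ xs × g ∈ xs × touch f g ≡ false) ⊎ (∀ {f g} → f ∈ xs → g ∈ xs → touch f g ≡ true)
touching-or-disjoint xs xs! with search xs (λ f → does (1 ≤? # xs (miss f)))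
... | inj₂ none = inj₂ λ {f} {g} f∈ g∈ → [ id , (λ fg → ⊥-elim (false≢true (none f∈) (dec-true (1 ≤? # xs (miss f)) (#-∈ g∈ (cong not fg))))) ]′ (true? (touch f g))
... | inj₁ (f , f∈ , h) with avoid xs! (miss f) [] (decidable-stable (1 ≤? # xs (miss f)) λ ≰ → false≢true (dec-false (1 ≤? # xs (miss f)) ≰) h)
... | g , g∈ , fg , _ = inj₁ (f , g , f∈ , g∈ , not-true fg)

two-zeros : ∀ {A : Set} (xs : List A) (Z : A → ℕ) {p q} → (∀ a → Z a ≤ 1) → p ∈ xs → q ∈ xs → p ≢ q →
            Z p ≡ 0 → Z q ≡ 0 → ∑ xs Z + 2 ≤ length xs
two-zeros xs Z {p} {q} Z≤1 p∈ q∈ p≢q Zp Zq = begin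
  ∑ xs Z + 2                          ≤⟨ +-monoʳ-≤ (∑ xs Z) (#-∈₂ {P = λ a → zero? (Z a)} p∈ q∈ p≢q (cong zero? Zp) (cong zero? Zq)) ⟩
  ∑ xs Z + # xs (λ a → zero? (Z a))   ≡⟨ ∑-+ xs Z (λ a → ⟦ zero? (Z a) ⟧) ⟨
  ∑ xs (λ a → Z a + ⟦ zero? (Z a) ⟧)  ≤⟨ ∑-≤const xs 1 (λ {a} _ → pointwise (Z a) (Z≤1 a)) ⟩
  length xs * 1                       ≡⟨ *-identityʳ _ ⟩
  length xs                           ∎
  where
  open ≤-Reasoning
  zero? : ℕ → Bool
  zero? zero = true
  zero? (suc _) = false
  pointwise : ∀ k → k ≤ 1 → k + ⟦ zero? k ⟧ ≤ 1
  pointwise 0 _ = ≤-refl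
  pointwise 1 _ = ≤-refl
  pointwise (suc (suc k)) (s≤s ())

edge-unique : ∀ {xs : List (Subset n)} {f g u v} → Free 2 xs → f ∈ xs → g ∈ xs → Edge f u v → Edge g u v → f ≡ g
edge-unique {u = u} {v} F f∈ g∈ e e′ = #≤1⇒≡ (λ k → lookup k u ∧ lookup k v) (deg₂≤1 F (apart e)) f∈ g∈
  (true-∧ (left e) (right e)) (true-∧ (left e′) (right e′))

module Cross {G H : List (Subset n)} (FG : Free 2 G) (FH : Free 2 H)
             (cross : ∀ {g h} → g ∈ G → h ∈ H → touch g h ≡ true) where

  private
    touches : ∀ {g h} → g ∈ G → h ∈ H → touch h g ≡ true
    touches {g} {h} g∈ h∈ = trans (touch-sym h g) (cross g∈ h∈)

    has₂ : Fin n → Fin n → Subset n → Bool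
    has₂ a b k = lookup k a ∧ lookup k b

    length-cover : ∀ Qs → (∀ {g} → g ∈ G → Any (λ Q → Q g ≡ true) Qs) → length G ≤ ∑ Qs (# G)
    length-cover Qs cover = ≤-trans (≤-reflexive (sym (#-all G (λ _ → true) (λ _ → refl)))) (#-cover G _ Qs (λ g∈ _ → cover g∈))

  length≤2δ : ∀ {δ h} → (∀ u → deg G u ≤ δ) → h ∈ H → length G ≤ 2 * δ
  length≤2δ {δ} {h} deg≤ h∈ with edge h (uniform FH h∈)
  ... | u , v , e = ≤-trans (length-cover ((λ k → lookup k u) ∷ (λ k → lookup k v) ∷ [])
          (λ {g} g∈ → [ here , there ∘ here ]′ (touch-edge⁻ e g (touches g∈ h∈))))
        (+-mono-≤ (deg≤ u) (+-monoˡ-≤ 0 (deg≤ v)))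

  -- If `h₁` and `h₂` share `t`, an edge of `G` passes through `t` (at most 3 do) or joins the other
  -- two ends. If they are disjoint, it is one of the four edges joining them.
  length≤4 : ∀ {h₁ h₂} → h₁ ∈ H → h₂ ∈ H → h₁ ≢ h₂ → length G ≤ 4
  length≤4 {h₁} {h₂} h₁∈ h₂∈ h₁≢h₂ with touch h₁ h₂ in eq
  ... | true with touch⁻ h₁ h₂ eq
  ...   | t , p , q with edge-at h₁ (uniform FH h₁∈) p | edge-at h₂ (uniform FH h₂∈) q
  ...   | v , e | w , e′ = ≤-trans (length-cover ((λ k → lookup k t) ∷ has₂ v w ∷ []) cover)
            (+-mono-≤ (deg≤3 FG t) (+-monoˡ-≤ 0 (deg₂≤1 FG v≢w)))
    where
    v≢w : v ≢ w
    v≢w refl = h₁≢h₂ (edge-unique FH h₁∈ h₂∈ e e′)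
    cover : ∀ {g} → g ∈ G → Any (λ Q → Q g ≡ true) ((λ k → lookup k t) ∷ has₂ v w ∷ [])
    cover {g} g∈ with touch-edge⁻ e g (touches g∈ h₁∈) | touch-edge⁻ e′ g (touches g∈ h₂∈)
    ... | inj₁ gt | _ = here gt
    ... | inj₂ _ | inj₁ gt = here gt
    ... | inj₂ gv | inj₂ gw = there (here (true-∧ gv gw))
  length≤4 {h₁} {h₂} h₁∈ h₂∈ h₁≢h₂ | false with edge h₁ (uniform FH h₁∈) | edge h₂ (uniform FH h₂∈)
  ... | u , v , e | w , z , e′ = ≤-trans (length-cover (has₂ u w ∷ has₂ u z ∷ has₂ v w ∷ has₂ v z ∷ []) cover)
            (+-mono-≤ (deg₂≤1 FG (differ (left e) (left e′))) (+-mono-≤ (deg₂≤1 FG (differ (left e) (right e′)))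
            (+-mono-≤ (deg₂≤1 FG (differ (right e) (left e′))) (+-monoˡ-≤ 0 (deg₂≤1 FG (differ (right e) (right e′)))))))
    where
    differ : ∀ {a b} → h₁ ∋ a → h₂ ∋ b → a ≢ b
    differ p q refl = false≢true (touch-false⁻ h₁ h₂ eq _ p) q
    cover : ∀ {g} → g ∈ G → Any (λ Q → Q g ≡ true) (has₂ u w ∷ has₂ u z ∷ has₂ v w ∷ has₂ v z ∷ [])
    cover {g} g∈ with touch-edge⁻ e g (touches g∈ h₁∈) | touch-edge⁻ e′ g (touches g∈ h₂∈)
    ... | inj₁ gu | inj₁ gw = here (true-∧ gu gw)
    ... | inj₁ gu | inj₂ gz = there (here (true-∧ gu gz))
    ... | inj₂ gv | inj₁ gw = there (there (here (true-∧ gv gw)))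
    ... | inj₂ gv | inj₂ gz = there (there (there (here (true-∧ gv gz))))

  -- If G had four edges, two of them, ab and cd, would be disjoint, so H would
  -- consist of at least three of the four edges between {a,b} and {c,d}.  Any
  -- further edge of G avoids one of these four, which then is the one missing
  -- from H, and so is the opposite edge.
  length≤3 : 3 ≤ length H → length G ≤ 3
  length≤3 3≤H with touching-or-disjoint G (unique FG)
  ... | inj₂ touching = intersecting-graph FG touching
  ... | inj₁ (g₁ , g₂ , g₁∈ , g₂∈ , g₁₂) with edge g₁ (uniform FG g₁∈) | edge g₂ (uniform FG g₂∈)
  ... | a , b , e₁ | c , d , e₂ = ≮⇒≥ four
    where
    -- Ends are indexed by Booleans so that `not` passes to the other end of the same edge.
    P Q : Bool → Fin n
    P true = a
    P false = b
    Q true = c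
    Q false = d
    P∈ : ∀ i → g₁ ∋ P i
    P∈ true = left e₁
    P∈ false = right e₁
    Q∈ : ∀ i → g₂ ∋ Q i
    Q∈ true = left e₂
    Q∈ false = right e₂
    P≢Q : ∀ i j → P i ≢ Q j
    P≢Q i j eq = false≢true (touch-false⁻ g₁ g₂ g₁₂ (P i) (P∈ i)) (subst (g₂ ∋_) (sym eq) (Q∈ j))
    pairs : List (Bool × Bool)
    pairs = (true , true) ∷ (true , false) ∷ (false , true) ∷ (false , false) ∷ []
    ∈-pairs : ∀ p → p ∈ pairs
    ∈-pairs (true , true) = here refl
    ∈-pairs (true , false) = there (here refl)
    ∈-pairs (false , true) = there (there (here refl))
    ∈-pairs (false , false) = there (there (there (here refl)))
    Z : Bool × Bool → ℕ
    Z (i , j) = deg₂ H (P i) (Q j)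
    3≤∑Z : 3 ≤ ∑ pairs Z
    3≤∑Z = ≤-trans 3≤H (≤-trans (≤-reflexive (sym (#-all H (λ _ → true) (λ _ → refl))))
             (#-cover H _ (map (λ (i , j) → has₂ (P i) (Q j)) pairs) (λ {h} h∈ _ → cover h∈)))
      where
      cover : ∀ {h} → h ∈ H → Any (λ R → R h ≡ true) (map (λ (i , j) → has₂ (P i) (Q j)) pairs)
      cover {h} h∈ with touch-edge⁻ e₁ h (cross g₁∈ h∈) | touch-edge⁻ e₂ h (cross g₂∈ h∈)
      ... | inj₁ p | inj₁ q = here (true-∧ p q)
      ... | inj₁ p | inj₂ q = there (here (true-∧ p q))
      ... | inj₂ p | inj₁ q = there (there (here (true-∧ p q)))
      ... | inj₂ p | inj₂ q = there (there (there (here (true-∧ p q))))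
    -- The four values of `Z` are at most 1 and sum to at least 3.
    unique-zero : ∀ p q → Z p ≡ 0 → Z q ≡ 0 → ¬ p ≢ q
    unique-zero p q Zp Zq p≢q = <⇒≱ (from-yes (4 <? 5))
      (≤-trans (+-monoˡ-≤ 2 3≤∑Z) (two-zeros pairs Z (λ (i , j) → deg₂≤1 FH (P≢Q i j)) (∈-pairs p) (∈-pairs q) p≢q Zp Zq))
    -- An edge of `H` through `P i` and `Q j` has no other points, yet `g` would have to touch it.
    missing : ∀ {g} i j → g ∈ G → g ∌ P i → g ∌ Q j → Z (i , j) ≡ 0
    missing {g} i j g∈ gi gj = #-none H _ λ {h} h∈ → ≢true λ both → let hi , hj = ∧-true both in absurd h∈ hi hj
      where
      absurd : ∀ {h} → h ∈ H → h ∋ P i → h ∋ Q j → Empty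
      absurd {h} h∈ hi hj with edge-at h (uniform FH h∈) hi
      ... | w , eh with edge-only eh hj
      ... | inj₁ Q≡P = P≢Q i j (sym Q≡P)
      ... | inj₂ refl with touch-edge⁻ eh g (touches g∈ h∈)
      ... | inj₁ gi′ = false≢true gi gi′
      ... | inj₂ gj′ = false≢true gj gj′
    not-both : ∀ {f g u v} → f ∈ G → g ∈ G → Edge f u v → g ≢ f → (g ∌ u) ⊎ (g ∌ v)
    not-both {f} {g} {u} {v} f∈ g∈ e g≢f with true? (lookup g u) | true? (lookup g v)
    ... | inj₂ gu | _ = inj₁ gu
    ... | inj₁ _ | inj₂ gv = inj₂ gv
    ... | inj₁ gu | inj₁ gv = ⊥-elim (g≢f (#≤1⇒≡ (has₂ u v) (deg₂≤1 FG (apart e)) g∈ f∈ (true-∧ gu gv) (true-∧ (left e) (right e))))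
    misses : ∀ {g} → g ∈ G → g ∉ g₁ ∷ g₂ ∷ [] → ∃[ i ] ∃[ j ] g ∌ P i × g ∌ Q j
    misses g∈ g∉ with not-both g₁∈ g∈ e₁ (g∉ ∘ here) | not-both g₂∈ g∈ e₂ (g∉ ∘ there ∘ here)
    ... | inj₁ p | inj₁ q = true , true , p , q
    ... | inj₁ p | inj₂ q = true , false , p , q
    ... | inj₂ p | inj₁ q = false , true , p , q
    ... | inj₂ p | inj₂ q = false , false , p , q
    -- Avoiding another end as well would produce a second zero of `Z`.
    contains : ∀ {g} i j → g ∈ G → g ∌ P i → g ∌ Q j → g ∋ P (not i) × g ∋ Q (not j)
    contains {g} i j g∈ gi gj =
      [ id , (λ p → ⊥-elim (unique-zero (i , j) (not i , j) (missing i j g∈ gi gj) (missing (not i) j g∈ p gj) (λ eq → Bool.not-¬ refl (cong proj₁ eq)))) ]′ (true? _) ,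
      [ id , (λ p → ⊥-elim (unique-zero (i , j) (i , not j) (missing i j g∈ gi gj) (missing i (not j) g∈ gi p) (λ eq → Bool.not-¬ refl (cong proj₂ eq)))) ]′ (true? _)
    four : ¬ 4 ≤ length G
    four 4≤ with avoid (unique FG) (λ _ → true) (g₁ ∷ g₂ ∷ []) (≤-trans (s≤s (s≤s (s≤s z≤n))) (≤-trans 4≤ (≤-reflexive (sym (length-∑ G)))))
    ... | g₃ , g₃∈ , _ , g₃∉ with avoid (unique FG) (λ _ → true) (g₃ ∷ g₁ ∷ g₂ ∷ []) (≤-trans 4≤ (≤-reflexive (sym (length-∑ G))))
    ... | g₄ , g₄∈ , _ , g₄∉ with misses g₃∈ g₃∉ | misses g₄∈ (g₄∉ ∘ there)
    ... | i , j , p , q | i′ , j′ , p′ , q′ =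
      -- Both further edges avoid the same pair, so both are the opposite edge, contrary to their
      -- being distinct.
      unique-zero (i , j) (i′ , j′) (missing i j g₃∈ p q) (missing i′ j′ g₄∈ p′ q′) λ { refl →
        let r , s = contains i j g₃∈ p q ; r′ , s′ = contains i j g₄∈ p′ q′ in
        g₄∉ (here (#≤1⇒≡ (has₂ (P (not i)) (Q (not j))) (deg₂≤1 FG (P≢Q (not i) (not j))) g₄∈ g₃∈ (true-∧ r′ s′) (true-∧ r s))) }

-- Intersecting 3-uniform families

record Triple {n} (f : Subset n) (x y z : Fin n) : Set where
  field
    x≢y : x ≢ y
    x≢z : x ≢ z
    y≢z : y ≢ z
    ∋x  : f ∋ x
    ∋y  : f ∋ y
    ∋z  : f ∋ z
    only : ∀ {w} → f ∋ w → w ≡ x ⊎ w ≡ y ⊎ w ≡ z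
    sum  : ∀ (h : Fin n → ℕ) → ∑ᶠ (λ w → ⟦ lookup f w ⟧ * h w) ≡ h x + (h y + h z)

open Triple

triple-at : ∀ (f : Subset n) {x y} → ∣ f ∣ ≡ 3 → x ≢ y → f ∋ x → f ∋ y → ∃[ z ] Triple f x y z
triple-at f {x} {y} h x≢y fx fy with edge-at (flip x f) (suc-injective (trans (∣flip∣ x f fx) h)) (trans (lookup-flip-≢ f (x≢y ∘ sym)) fy)
... | z , e = z , record
  { x≢y = x≢y ; x≢z = z≢x ∘ sym ; y≢z = Edge.apart e ; ∋x = fx ; ∋y = fy
  ; ∋z = trans (sym (lookup-flip-≢ f z≢x)) (Edge.right e)
  ; only = only′
  ; sum = λ h → trans (∑ᶠ-flip x f h fx) (cong (h x +_) (Edge.edge-sum e h))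
  }
  where
  z≢x : z ≢ x
  z≢x = ∋-∌⇒≢ (flip x f) (Edge.right e) (flip-∌ x f fx)
  only′ : ∀ {w} → f ∋ w → w ≡ x ⊎ w ≡ y ⊎ w ≡ z
  only′ {w} fw with w Fin.≟ x
  ... | yes w≡x = inj₁ w≡x
  ... | no w≢x = inj₂ (Edge.edge-only e (trans (lookup-flip-≢ f w≢x) fw))

triple : ∀ (f : Subset n) → ∣ f ∣ ≡ 3 → ∃[ x ] ∃[ y ] ∃[ z ] Triple f x y z
triple f h with ∣∣≡suc f h
... | x , fx with ∣∣≡suc (flip x f) (suc-injective (trans (∣flip∣ x f fx) h))
... | y , fy = x , y , triple-at f h (y≢x ∘ sym) fx (trans (sym (lookup-flip-≢ f y≢x)) fy)
  where
  y≢x : y ≢ x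
  y≢x = ∋-∌⇒≢ (flip x f) fy (flip-∌ x f fx)

touch-triple⁻ : ∀ {f : Subset n} {x y z} → Triple f x y z → ∀ g → touch f g ≡ true → g ∋ x ⊎ g ∋ y ⊎ g ∋ z
touch-triple⁻ {f = f} t g h with touch⁻ f g h
... | w , fw , gw with only t fw
... | inj₁ refl = inj₁ gw
... | inj₂ (inj₁ refl) = inj₂ (inj₁ gw)
... | inj₂ (inj₂ refl) = inj₂ (inj₂ gw)

triple-only : ∀ {f : Subset n} {x y z} → ∣ f ∣ ≡ 3 → x ≢ y → x ≢ z → y ≢ z → f ∋ x → f ∋ y → f ∋ z →
              ∀ {w} → f ∋ w → w ≡ x ⊎ w ≡ y ⊎ w ≡ z
triple-only {f = f} {x} {y} {z} h x≢y x≢z y≢z fx fy fz fw =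
  let z′ , t = triple-at f h x≢y fx fy
      z≡z′ = [ (λ z≡x → ⊥-elim (x≢z (sym z≡x))) , [ (λ z≡y → ⊥-elim (y≢z (sym z≡y))) , id ]′ ]′ (only t fz)
  in [ inj₁ , [ inj₂ ∘ inj₁ , (λ w≡z′ → inj₂ (inj₂ (trans w≡z′ (sym z≡z′)))) ]′ ]′ (only t fw)

swap₁₂ : ∀ {f : Subset n} {x y z} → Triple f x y z → Triple f y x z
swap₁₂ {x = x} {y} {z} t = record
  { x≢y = x≢y t ∘ sym ; x≢z = y≢z t ; y≢z = x≢z t ; ∋x = ∋y t ; ∋y = ∋x t ; ∋z = ∋z t
  ; only = [ inj₂ ∘ inj₁ , [ inj₁ , inj₂ ∘ inj₂ ]′ ]′ ∘ only t
  ; sum = λ h → trans (sum t h) (l (h x) (h y) (h z)) }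
  where
  l : ∀ a b c → a + (b + c) ≡ b + (a + c)
  l = solve-∀

swap₂₃ : ∀ {f : Subset n} {x y z} → Triple f x y z → Triple f x z y
swap₂₃ {x = x} {y} {z} t = record
  { x≢y = x≢z t ; x≢z = x≢y t ; y≢z = y≢z t ∘ sym ; ∋x = ∋x t ; ∋y = ∋z t ; ∋z = ∋y t
  ; only = [ inj₁ , [ inj₂ ∘ inj₂ , inj₂ ∘ inj₁ ]′ ]′ ∘ only t
  ; sum = λ h → trans (sum t h) (cong (h x +_) (+-comm (h y) (h z))) }

length≡deg : ∀ (xs : List (Subset n)) x → length xs ≡ deg xs x + # xs (λ f → not (lookup f x))
length≡deg xs x = length-split xs (λ f → lookup f x)

module Intersecting {E : List (Subset n)} (F : Free 3 E) (meets : ∀ {f g} → f ∈ E → g ∈ E → touch f g ≡ true) where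

  private
    _without_ _and_ _nor_ : Fin n → Fin n → Subset n → Bool
    (x without y) f = not (lookup f y) ∧ lookup f x
    (x and y) f = lookup f x ∧ lookup f y
    (x nor y) f = not (lookup f x) ∧ not (lookup f y)

  length-parts : ∀ x y → length E ≡ deg₂ E x y + # E (x without y) + (# E (y without x) + # E (x nor y))
  length-parts x y = begin
    length E                                                    ≡⟨ length≡deg E x ⟩
    deg E x + # E (λ f → not (lookup f x))                      ≡⟨ cong₂ _+_ (#-split E (λ f → lookup f x) (λ f → lookup f y)) (#-split E (λ f → not (lookup f x)) (λ f → lookup f y)) ⟩
    deg₂ E x y + # E (λ f → lookup f x ∧ not (lookup f y)) + (# E (y without x) + # E (x nor y))
      ≡⟨ cong (λ k → deg₂ E x y + k + (# E (y without x) + # E (x nor y))) (∑-cong E (λ {f} _ → cong ⟦_⟧ (Bool.∧-comm (lookup f x) (not (lookup f y))))) ⟩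
    deg₂ E x y + # E (x without y) + (# E (y without x) + # E (x nor y))  ∎
    where open ≡-Reasoning

  -- All members through `x` meet `k`, hence contain `x` and one of the three points of `k`.
  missed-deg : ∀ {δ} → (∀ {u v} → u ≢ v → deg₂ E u v ≤ δ) → ∀ {x k p q r} → k ∈ E → k ∌ x → Triple k p q r →
               deg E x ≤ δ + (δ + (δ + 0))
  missed-deg codeg {x} {k} {p} {q} {r} k∈ kx t = ≤-trans (#-cover E _ ((x and p) ∷ (x and q) ∷ (x and r) ∷ []) cover)
    (+-mono-≤ (codeg (differ (∋x t))) (+-mono-≤ (codeg (differ (∋y t))) (+-monoˡ-≤ 0 (codeg (differ (∋z t))))))
    where
    differ : ∀ {p} → k ∋ p → x ≢ p
    differ kp refl = false≢true kx kp
    cover : ∀ {f} → f ∈ E → f ∋ x → Any (λ Q → Q f ≡ true) ((x and p) ∷ (x and q) ∷ (x and r) ∷ [])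
    cover {f} f∈ fx =
      [ (λ fp → here (true-∧ fx fp)) , [ (λ fq → there (here (true-∧ fx fq))) , (λ fr → there (there (here (true-∧ fx fr)))) ]′ ]′
        (touch-triple⁻ t f (meets k∈ f∈))

  star-or-small : ∀ {δ} → (∀ {u v} → u ≢ v → deg₂ E u v ≤ δ) → ∀ x → length E ≤ 10 ⊎ deg E x ≤ δ + (δ + (δ + 0))
  star-or-small {δ} codeg x with search E (λ f → not (lookup f x))
  ... | inj₂ none = inj₁ (begin
    length E                    ≡⟨ #-all E (λ f → lookup f x) (λ f∈ → Bool.not-injective (none f∈)) ⟨
    deg E x                     ≡⟨ length-link x E ⟨
    length (link x E)           ≤⟨ graph-10 (link-free x F) ⟩
    10                          ∎)
    where open ≤-Reasoning
  ... | inj₁ (k , k∈ , kx) = inj₂ (missed-deg codeg k∈ (not-true kx) (proj₂ (proj₂ (proj₂ (triple k (uniform F k∈))))))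

  private
    -- The members through `x` but not `y`, with `x` removed. Together with `half y x` it forms a
    -- cross-intersecting pair of graphs.
    half : Fin n → Fin n → List (Subset n)
    half x y = link x (select (λ f → not (lookup f y)) E)

    half-free : ∀ x y → Free 2 (half x y)
    half-free x y = link-free x (select-free (λ f → not (lookup f y)) F)

    ∈-half⁻ : ∀ x y {g} → g ∈ half x y → ∃[ f ] f ∈ E × f ∋ x × f ∌ y × g ≡ flip x f
    ∈-half⁻ x y g∈ with ∈-link⁻ x (select (λ f → not (lookup f y)) E) g∈
    ... | f , f∈ , fx , refl with ∈-select⁻ (λ f → not (lookup f y)) E f∈
    ... | f∈E , fy = f , f∈E , fx , not-true fy , refl

    length-half : ∀ x y → length (half x y) ≡ # E (x without y)
    length-half x y = trans (length-link x (select (λ f → not (lookup f y)) E)) (#-select (λ f → not (lookup f y)) (λ f → lookup f x) E)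

    -- A common point of `f` and `k` is neither `x`, which `k` misses, nor `y`, which `f` misses, so
    -- it survives both removals.
    half-cross : ∀ x y {g h} → g ∈ half x y → h ∈ half y x → touch g h ≡ true
    half-cross x y g∈ h∈ with ∈-half⁻ x y g∈ | ∈-half⁻ y x h∈
    ... | f , f∈ , fx , fy , refl | k , k∈ , ky , kx , refl with touch⁻ f k (meets f∈ k∈)
    ... | w , fw , kw = touch⁺ (flip x f) (flip y k) w
      (trans (lookup-flip-≢ f (∋-∌⇒≢ k kw kx)) fw)
      (trans (lookup-flip-≢ k (∋-∌⇒≢ f fw fy)) kw)

    half-deg : ∀ {δ} → (∀ {u v} → u ≢ v → deg₂ E u v ≤ δ) → ∀ x y u → deg (half x y) u ≤ δ
    half-deg codeg x y u with x Fin.≟ u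
    ... | yes refl = ≤-trans (≤-reflexive (#-none (half x y) (λ f → lookup f x) x∉)) z≤n
      where
      x∉ : ∀ {g} → g ∈ half x y → g ∌ x
      x∉ g∈ with ∈-half⁻ x y g∈
      ... | f , _ , fx , _ , refl = flip-∌ x f fx
    ... | no x≢u = ≤-trans (≤-reflexive (trans (deg-link (select (λ f → not (lookup f y)) E) x≢u)
          (#-select (λ f → not (lookup f y)) (x and u) E)))
        (≤-trans (#-mono E (λ {f} _ h → proj₂ (∧-true {not (lookup f y)} h))) (codeg x≢u))

  module HalfCross (x y : Fin n) = Cross (half-free x y) (half-free y x) (half-cross x y)

  only≤2δ : ∀ {δ} → (∀ {u v} → u ≢ v → deg₂ E u v ≤ δ) → ∀ x y → 1 ≤ # E (y without x) → # E (x without y) ≤ 2 * δ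
  only≤2δ {δ} codeg x y 1≤ with avoid (unique (half-free y x)) (λ _ → true) [] (≤-trans 1≤ (≤-reflexive (trans (sym (length-half y x)) (sym (length-∑ (half y x))))))
  ... | h , h∈ , _ = subst (_≤ 2 * δ) (length-half x y) (HalfCross.length≤2δ x y (half-deg codeg x y) h∈)

  only≤4 : ∀ x y → 2 ≤ # E (y without x) → # E (x without y) ≤ 4
  only≤4 x y 2≤ = subst (_≤ 4) (length-half x y) (go (half y x) (λ h∈ → h∈) (unique (half-free y x)) (subst (2 ≤_) (sym (length-half y x)) 2≤))
    where
    go : ∀ hs → (∀ {h} → h ∈ hs → h ∈ half y x) → Unique hs → 2 ≤ length hs → length (half x y) ≤ 4
    go (_ ∷ _ ∷ _) ⊆ ((h≢ ∷ _) ∷ _) _ = HalfCross.length≤4 x y (⊆ (here refl)) (⊆ (there (here refl))) h≢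
    go (_ ∷ []) _ _ (s≤s ())

  only≤3 : ∀ x y → 3 ≤ # E (y without x) → # E (x without y) ≤ 3
  only≤3 x y 3≤ = subst (_≤ 3) (length-half x y) (HalfCross.length≤3 x y (subst (3 ≤_) (sym (length-half y x)) 3≤))

  -- If both parts have at least 2 members, then either one has exactly 2 and the other at most 4,
  -- or both have exactly 3.
  only+only : ∀ x y → 1 ≤ # E (x without y) → 1 ≤ # E (y without x) →
              # E (x without y) + # E (y without x) ≤ 6 ⊎ # E (x without y) ≡ 1 ⊎ # E (y without x) ≡ 1
  only+only x y 1≤g 1≤h = bound _ _ 1≤g 1≤h (only≤4 x y) (only≤4 y x) (only≤3 x y) (only≤3 y x)
    where
    bound : ∀ g h → 1 ≤ g → 1 ≤ h → (2 ≤ h → g ≤ 4) → (2 ≤ g → h ≤ 4) → (3 ≤ h → g ≤ 3) → (3 ≤ g → h ≤ 3) →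
            g + h ≤ 6 ⊎ g ≡ 1 ⊎ h ≡ 1
    bound 1 h _ _ _ _ _ _ = inj₂ (inj₁ refl)
    bound (suc (suc g)) 1 _ _ _ _ _ _ = inj₂ (inj₂ refl)
    bound (suc (suc zero)) (suc (suc h)) _ _ _ h≤4 _ _ = inj₁ (+-monoʳ-≤ 2 (h≤4 ≤-refl))
    bound (suc (suc (suc g))) (suc (suc zero)) _ _ g≤4 _ _ _ = inj₁ (+-monoˡ-≤ 2 (g≤4 ≤-refl))
    bound (suc (suc (suc g))) (suc (suc (suc h))) _ _ _ _ g≤3 h≤3 = inj₁ (+-mono-≤ (g≤3 (s≤s (s≤s (s≤s z≤n)))) (h≤3 (s≤s (s≤s (s≤s z≤n)))))

  -- Members are sorted by which of `x` and `y` they contain. If one of the one-sided parts is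
  -- empty, the other point has degree at most 3δ unless the family is a star, and at most `r`
  -- members remain. If the two parts have total at most 6, the count is δ + 6 + r. Otherwise one
  -- part is a single triple and 3 + 1 + 6 = 10. The uses are (δ, r) = (3, 1) and (2, 2).
  pair-bound : ∀ {δ r x y} → (∀ {u v} → u ≢ v → deg₂ E u v ≤ δ) → x ≢ y → δ ≤ 3 → δ + (6 + r) ≤ 10 → δ + (δ + (δ + 0)) + r ≤ 10 →
               # E (x nor y) ≤ r →
               (# E (y without x) ≡ 1 → # E (x without y) + # E (x nor y) ≤ 6) →
               (# E (x without y) ≡ 1 → # E (y without x) + # E (x nor y) ≤ 6) →
               length E ≤ 10
  pair-bound {δ} {r} {x} {y} codeg x≢y δ≤3 δ+6+r≤10 3δ+r≤10 rest≤r case₁ case₂ with 1 ≤? # E (x without y) | 1 ≤? # E (y without x)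
  ... | _ | no h≰ = [ id , (λ dx≤ → begin
      length E                                              ≡⟨ length≡deg E x ⟩
      deg E x + # E (λ f → not (lookup f x))                ≡⟨ cong (deg E x +_) (#-split E (λ f → not (lookup f x)) (λ f → lookup f y)) ⟩
      deg E x + (# E (y without x) + # E (x nor y))        ≤⟨ +-mono-≤ dx≤ (+-mono-≤ (≤-pred (≰⇒> h≰)) rest≤r) ⟩
      δ + (δ + (δ + 0)) + r                                 ≤⟨ 3δ+r≤10 ⟩
      10                                                    ∎) ]′ (star-or-small codeg x)
    where open ≤-Reasoning
  ... | no g≰ | _ = [ id , (λ dy≤ → begin
      length E                                              ≡⟨ length≡deg E y ⟩
      deg E y + # E (λ f → not (lookup f y))                ≡⟨ cong (deg E y +_) (#-split E (λ f → not (lookup f y)) (λ f → lookup f x)) ⟩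
      deg E y + (# E (x without y) + # E (y nor x))        ≤⟨ +-mono-≤ dy≤ (+-mono-≤ (≤-pred (≰⇒> g≰)) (≤-trans (#-mono E (λ {f} _ h → let a , b = ∧-true {not (lookup f y)} h in true-∧ b a)) rest≤r)) ⟩
      δ + (δ + (δ + 0)) + r                                 ≤⟨ 3δ+r≤10 ⟩
      10                                                    ∎) ]′ (star-or-small codeg y)
    where open ≤-Reasoning
  ... | yes 1≤g | yes 1≤h with only+only x y 1≤g 1≤h
  ...   | inj₁ ≤6 = begin
      length E                                                            ≡⟨ length-parts x y ⟩
      deg₂ E x y + # E (x without y) + (# E (y without x) + # E (x nor y))  ≡⟨ l (deg₂ E x y) (# E (x without y)) (# E (y without x)) _ ⟩
      deg₂ E x y + (# E (x without y) + # E (y without x) + # E (x nor y))  ≤⟨ +-mono-≤ (codeg x≢y) (+-mono-≤ ≤6 rest≤r) ⟩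
      δ + (6 + r)                                                         ≤⟨ δ+6+r≤10 ⟩
      10                                                                  ∎
    where
    open ≤-Reasoning
    l : ∀ a b c d → a + b + (c + d) ≡ a + (b + c + d)
    l = solve-∀
  ...   | inj₂ (inj₁ g≡1) = begin
      length E                                                            ≡⟨ length-parts x y ⟩
      deg₂ E x y + # E (x without y) + (# E (y without x) + # E (x nor y))  ≤⟨ +-mono-≤ (+-mono-≤ (≤-trans (codeg x≢y) δ≤3) (≤-reflexive g≡1)) (case₂ g≡1) ⟩
      10                                                                  ∎
    where open ≤-Reasoning
  ...   | inj₂ (inj₂ h≡1) = begin
      length E                                                            ≡⟨ length-parts x y ⟩
      deg₂ E x y + # E (x without y) + (# E (y without x) + # E (x nor y))  ≡⟨ l (deg₂ E x y) (# E (x without y)) (# E (y without x)) _ ⟩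
      deg₂ E x y + # E (y without x) + (# E (x without y) + # E (x nor y))  ≤⟨ +-mono-≤ (+-mono-≤ (≤-trans (codeg x≢y) δ≤3) (≤-reflexive h≡1)) (case₁ h≡1) ⟩
      10                                                                  ∎
    where
    open ≤-Reasoning
    l : ∀ a b c d → a + b + (c + d) ≡ a + c + (b + d)
    l = solve-∀

  private
    Member : Fin n → Fin n → Fin n → Set
    Member x y a = ∃[ f ] f ∈ E × Triple f x y a

    swap : ∀ {x y a} → Member x y a → Member y x a
    swap (f , f∈ , t) = f , f∈ , swap₁₂ t

    nor-sym : ∀ x y → # E (y nor x) ≤ # E (x nor y)
    nor-sym x y = #-mono E (λ {f} _ h → let a , b = ∧-true {not (lookup f y)} h in true-∧ b a)

    member : ∀ {x y} → x ≢ y → ∀ L → length L < deg₂ E x y → ∃[ f ] f ∉ L × f ∈ E × ∃[ a ] Triple f x y a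
    member {x} {y} x≢y L L< =
      let f , f∈ , fxy , f∉ = avoid (unique F) (x and y) L L<
          fx , fy = ∧-true {lookup f x} fxy
      in f , f∉ , f∈ , triple-at f (uniform F f∈) x≢y fx fy

    thirds-distinct : ∀ {x y a b f g} → f ∈ E → g ∈ E → Triple f x y a → Triple g x y b → f ≢ g → a ≢ b
    thirds-distinct {x} {y} {a} f∈ g∈ s t f≢g refl = f≢g (#≤1⇒≡ (λ k → lookup k x ∧ (lookup k y ∧ lookup k a))
      (deg₃≤1 F (x≢y s) (x≢z s) (y≢z s)) f∈ g∈ (true-∧ (∋x s) (true-∧ (∋y s) (∋z s))) (true-∧ (∋x t) (true-∧ (∋y t) (∋z t))))

    -- `k` must meet the triple `x y a` and can do so only in `a`.
    third∈ : ∀ {x y a k} → k ∈ E → (x nor y) k ≡ true → Member x y a → k ∋ a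
    third∈ {x} {y} {a} {k} k∈ h (f , f∈ , t) =
      let kx , ky = ∧-true {not (lookup k x)} h in
      [ (λ p → ⊥-elim (false≢true (not-true kx) p)) , [ (λ p → ⊥-elim (false≢true (not-true ky) p)) , id ]′ ]′
        (touch-triple⁻ t k (meets f∈ k∈))

    codeg≤3 : ∀ {u v} → u ≢ v → deg₂ E u v ≤ 3
    codeg≤3 = deg₂≤3 F

    -- A member through `x` but not `y` meets `h` in `t` or `v`. At most 3 contain `x` and `v`. Of
    -- the at most 3 containing `x` and `t`, one is the triple `x y t`, which contains `y`.
    without≤5 : ∀ {x y t v h} → Member x y t → h ∈ E → h ∌ x → Triple h y t v → # E (x without y) ≤ 5
    without≤5 {x} {y} {t} {v} {h} (f , f∈ , s) h∈ hx e =
      ≤-trans (#-cover E _ (not-y ∷ (x and v) ∷ []) cover) (+-mono-≤ not-y≤2 (+-monoˡ-≤ 0 (codeg≤3 x≢v)))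
      where
      not-y : Subset n → Bool
      not-y g = (x and t) g ∧ not (lookup g y)
      x≢v : x ≢ v
      x≢v refl = false≢true hx (∋z e)
      not-y≤2 : # E not-y ≤ 2
      not-y≤2 = +-cancelˡ-≤ 1 _ 2 (≤-trans (+-monoˡ-≤ (# E not-y)
        (#-∈ {P = λ g → (x and t) g ∧ lookup g y} f∈ (true-∧ (true-∧ (∋x s) (∋z s)) (∋y s))))
        (≤-trans (≤-reflexive (sym (#-split E (x and t) (λ g → lookup g y)))) (codeg≤3 (x≢z s))))
      cover : ∀ {g} → g ∈ E → (x without y) g ≡ true → Any (λ Q → Q g ≡ true) (not-y ∷ (x and v) ∷ [])
      cover {g} g∈ p = let gy , gx = ∧-true {not (lookup g y)} p in
        [ (λ gy′ → ⊥-elim (false≢true (not-true gy) gy′)) , [ (λ gt → here (true-∧ (true-∧ gx gt) gy)) , (λ gv → there (here (true-∧ gx gv))) ]′ ]′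
          (touch-triple⁻ e g (meets h∈ g∈))

    nor≤1 : ∀ {x y a b c} → Member x y a → Member x y b → Member x y c → a ≢ b → a ≢ c → b ≢ c → # E (x nor y) ≤ 1
    nor≤1 {x} {y} ma mb mc a≢b a≢c b≢c = ≤-trans
      (#-mono E λ k∈ h → true-∧ (third∈ {x} {y} k∈ h ma) (true-∧ (third∈ {x} {y} k∈ h mb) (third∈ {x} {y} k∈ h mc)))
      (deg₃≤1 F a≢b a≢c b≢c)

    -- If some `k` misses both `x` and `y`, then `k` is the triple `a b c` and the only one of its
    -- kind; the single member through `y` but not `x` meets it in one of `a`, `b`, `c`, so
    -- `without≤5` gives 5 + 1. If there is no such `k`, the bound is 2 · 3 + 0.
    without+nor≤6 : ∀ {x y a b c} → Member x y a → Member x y b → Member x y c → a ≢ b → a ≢ c → b ≢ c →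
                    # E (y without x) ≡ 1 → # E (x without y) + # E (x nor y) ≤ 6
    without+nor≤6 {x} {y} {a} {b} {c} ma mb mc a≢b a≢c b≢c ≡1 = conclude (search E (x nor y))
      where
      at : ∀ {t h} → Member x y t → h ∈ E → h ∋ y → h ∌ x → h ∋ t → # E (x without y) ≤ 5
      at {t} {h} m@(_ , _ , s) h∈ hy hx ht = without≤5 m h∈ hx (proj₂ (triple-at h (uniform F h∈) (y≢z s) hy ht))
      meeting : ∀ k → k ∈ E → (x nor y) k ≡ true → # E (x without y) ≤ 5
      meeting k k∈ p =
        let h , h∈ , q , _ = avoid (unique F) (y without x) [] (≤-reflexive (sym ≡1))
            hx , hy = ∧-true {not (lookup h x)} q
            t , kt , ht = touch⁻ k h (meets k∈ h∈)
            pick : ∀ {a} → Member x y a → t ≡ a → # E (x without y) ≤ 5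
            pick m t≡a = at m h∈ hy (not-true hx) (subst (h ∋_) t≡a ht)
        in [ pick ma , [ pick mb , pick mc ]′ ]′
             (triple-only {f = k} (uniform F k∈) a≢b a≢c b≢c (third∈ {x} {y} k∈ p ma) (third∈ {x} {y} k∈ p mb) (third∈ {x} {y} k∈ p mc) kt)
      conclude : (∃[ k ] k ∈ E × (x nor y) k ≡ true) ⊎ (∀ {k} → k ∈ E → (x nor y) k ≡ false) → # E (x without y) + # E (x nor y) ≤ 6
      conclude (inj₁ (k , k∈ , p)) = +-mono-≤ (meeting k k∈ p) (nor≤1 ma mb mc a≢b a≢c b≢c)
      conclude (inj₂ none) = +-mono-≤ (only≤2δ codeg≤3 x y (≤-reflexive (sym ≡1))) (≤-reflexive (#-none E (x nor y) none))

    codeg-3 : ∀ {x y} → x ≢ y → 3 ≤ deg₂ E x y → length E ≤ 10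
    codeg-3 {x} {y} x≢y 3≤ =
      let f , _ , f∈ , a , s = member x≢y [] (≤-trans (s≤s z≤n) 3≤)
          g , g∉ , g∈ , b , t = member x≢y (f ∷ []) (≤-trans (s≤s (s≤s z≤n)) 3≤)
          h , h∉ , h∈ , c , r = member x≢y (g ∷ f ∷ []) 3≤
          a≢b = thirds-distinct f∈ g∈ s t (λ f≡g → g∉ (here (sym f≡g)))
          a≢c = thirds-distinct f∈ h∈ s r (λ f≡h → h∉ (there (here (sym f≡h))))
          b≢c = thirds-distinct g∈ h∈ t r (λ g≡h → h∉ (here (sym g≡h)))
          ma = f , f∈ , s
          mb = g , g∈ , t
          mc = h , h∈ , r
      in pair-bound {3} {1} codeg≤3 x≢y ≤-refl ≤-refl ≤-refl (nor≤1 ma mb mc a≢b a≢c b≢c)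
           (without+nor≤6 ma mb mc a≢b a≢c b≢c)
           (λ ≡1 → ≤-trans (+-monoʳ-≤ (# E (y without x)) (nor-sym y x)) (without+nor≤6 (swap ma) (swap mb) (swap mc) a≢b a≢c b≢c ≡1))

    nor≤deg₂ : ∀ {x y a b} → Member x y a → Member x y b → # E (x nor y) ≤ deg₂ E a b
    nor≤deg₂ {x} {y} {a} {b} ma mb = #-mono E {x nor y} {a and b} λ k∈ h → true-∧ (third∈ {x} {y} k∈ h ma) (third∈ {x} {y} k∈ h mb)

    codeg-2 : ∀ {x y} → (∀ {u v} → u ≢ v → deg₂ E u v ≤ 2) → x ≢ y → 2 ≤ deg₂ E x y → length E ≤ 10
    codeg-2 {x} {y} codeg x≢y 2≤ =
      let f , _ , f∈ , a , s = member x≢y [] (≤-trans (s≤s z≤n) 2≤)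
          g , g∉ , g∈ , b , t = member x≢y (f ∷ []) 2≤
      in conclude (≤-trans (nor≤deg₂ (f , f∈ , s) (g , g∈ , t)) (codeg (thirds-distinct f∈ g∈ s t (λ f≡g → g∉ (here (sym f≡g))))))
      where
      conclude : # E (x nor y) ≤ 2 → length E ≤ 10
      conclude nor≤2 = pair-bound {2} {2} codeg x≢y (from-yes (2 ≤? 3)) ≤-refl (from-yes (8 ≤? 10)) nor≤2
           (λ ≡1 → +-mono-≤ (only≤2δ codeg x y (≤-reflexive (sym ≡1))) nor≤2)
           (λ ≡1 → +-mono-≤ (only≤2δ codeg y x (≤-reflexive (sym ≡1))) nor≤2)

    -- Every member meets `f` in one of its three points, and outside the star case each of these
    -- has degree at most 3.
    codeg-1 : (∀ {u v} → u ≢ v → deg₂ E u v ≤ 1) → ∀ {f x y z} → f ∈ E → Triple f x y z → length E ≤ 10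
    codeg-1 codeg {f} {x} {y} {z} f∈ t = combine (star-or-small codeg x) (star-or-small codeg y) (star-or-small codeg z)
      where
      open ≤-Reasoning
      cover : ∀ {g} → g ∈ E → Any (λ Q → Q g ≡ true) ((λ k → lookup k x) ∷ (λ k → lookup k y) ∷ (λ k → lookup k z) ∷ [])
      cover {g} g∈ = [ here , [ there ∘ here , there ∘ there ∘ here ]′ ]′ (touch-triple⁻ t g (meets f∈ g∈))
      combine : length E ≤ 10 ⊎ deg E x ≤ 3 → length E ≤ 10 ⊎ deg E y ≤ 3 → length E ≤ 10 ⊎ deg E z ≤ 3 → length E ≤ 10
      combine (inj₁ ≤10) _ _ = ≤10
      combine _ (inj₁ ≤10) _ = ≤10
      combine _ _ (inj₁ ≤10) = ≤10
      combine (inj₂ dx) (inj₂ dy) (inj₂ dz) = begin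
        length E                                  ≡⟨ #-all E (λ _ → true) (λ _ → refl) ⟨
        # E (λ _ → true)                          ≤⟨ #-cover E _ ((λ k → lookup k x) ∷ (λ k → lookup k y) ∷ (λ k → lookup k z) ∷ []) (λ g∈ _ → cover g∈) ⟩
        deg E x + (deg E y + (deg E z + 0))       ≤⟨ +-mono-≤ dx (+-mono-≤ dy (+-monoˡ-≤ 0 dz)) ⟩
        9                                         ≤⟨ from-yes (9 ≤? 10) ⟩
        10                                        ∎

    large-codeg : ∀ c → (∃[ x ] ∃[ y ] x ≢ y × suc c ≤ deg₂ E x y) ⊎ (∀ {x y} → x ≢ y → deg₂ E x y ≤ c)
    large-codeg c with Fin.any? (λ x → Fin.any? (λ y → ¬? (x Fin.≟ y) ×-dec (suc c ≤? deg₂ E x y)))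
    ... | yes (x , y , x≢y , c<) = inj₁ (x , y , x≢y , c<)
    ... | no none = inj₂ λ {x} {y} x≢y → ≮⇒≥ λ c< → none (x , y , x≢y , c<)

    nonempty-case : (∀ {u v} → u ≢ v → deg₂ E u v ≤ 1) → ∀ E′ → (∀ {f} → f ∈ E′ → f ∈ E) → length E ≤ 10 ⊎ E′ ≡ []
    nonempty-case codeg [] _ = inj₂ refl
    nonempty-case codeg (f ∷ _) ⊆ = let f∈ = ⊆ (here refl) in inj₁ (codeg-1 codeg f∈ (proj₂ (proj₂ (proj₂ (triple f (uniform F f∈))))))

  length≤10 : length E ≤ 10
  length≤10 with large-codeg 2
  ... | inj₁ (x , y , x≢y , 3≤) = codeg-3 x≢y 3≤
  ... | inj₂ ≤2 with large-codeg 1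
  ... | inj₁ (x , y , x≢y , 2≤) = codeg-2 ≤2 x≢y 2≤
  ... | inj₂ ≤1 = [ id , (λ E≡[] → ≤-trans (≤-reflexive (cong length E≡[])) z≤n) ]′ (nonempty-case ≤1 E id)

-- Counting pairs of touching triples

flip-edge : ∀ {f : Subset n} {x y z} → Triple f x y z → Edge (flip x f) y z
flip-edge {f = f} {x} {y} {z} t = record
  { apart = y≢z t
  ; left = trans (lookup-flip-≢ f (x≢y t ∘ sym)) (∋y t)
  ; right = trans (lookup-flip-≢ f (x≢z t ∘ sym)) (∋z t)
  ; edge-only = λ {w} fw → [ (λ w≡x → ⊥-elim (∋-∌⇒≢ (flip x f) fw (flip-∌ x f (∋x t)) w≡x)) , id ]′
                        (only t (trans (sym (lookup-flip-≢ f (∋-∌⇒≢ (flip x f) fw (flip-∌ x f (∋x t))))) fw))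
  ; edge-sum = λ h → +-cancelˡ-≡ (h x) _ _ (trans (sym (∑ᶠ-flip x f h (∋x t))) (sum t h))
  }

touch-flip : ∀ {f : Subset n} {x y z} → Triple f x y z → ∀ g → touch (flip x f) (flip x g) ≡ lookup g y ∨ lookup g z
touch-flip {x = x} t g = trans (touch-edge (flip-edge t) (flip x g))
  (cong₂ _∨_ (lookup-flip-≢ g (x≢y t ∘ sym)) (lookup-flip-≢ g (x≢z t ∘ sym)))

touch-triple : ∀ {f : Subset n} {x y z} → Triple f x y z → ∀ g → touch f g ≡ lookup g x ∨ (lookup g y ∨ lookup g z)
touch-triple {f = f} {x} {y} {z} t g with touch f g in eq
... | false rewrite touch-false⁻ f g eq x (∋x t) | touch-false⁻ f g eq y (∋y t) | touch-false⁻ f g eq z (∋z t) = refl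
... | true = [ (λ gx → sym (cong (_∨ (lookup g y ∨ lookup g z)) gx))
             , [ (λ gy → sym (trans (cong (λ b → lookup g x ∨ (b ∨ lookup g z)) gy) (Bool.∨-zeroʳ (lookup g x))))
               , (λ gz → sym (trans (cong (λ b → lookup g x ∨ (lookup g y ∨ b)) gz) (trans (cong (lookup g x ∨_) (Bool.∨-zeroʳ (lookup g y))) (Bool.∨-zeroʳ (lookup g x))))) ]′ ]′
             (touch-triple⁻ t g eq)

-- For `f` through `v`, this is the value of `τ` at `flip v f` in the link of `v`: the members
-- through `v` that meet `f` in a further point.
link-τ : List (Subset n) → Subset n → Fin n → ℕ
link-τ xs f v = ∑ xs (λ g → ⟦ lookup g v ⟧ * ⟦ touch (flip v f) (flip v g) ⟧)

touching-pairs-link : ∀ (xs : List (Subset n)) v → touching-pairs (link v xs) ≡ ∑ xs (λ f → ⟦ lookup f v ⟧ * link-τ xs f v)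
touching-pairs-link xs v = trans (∑-link v xs (τ (link v xs)))
  (∑-cong xs (λ {f} _ → cong (⟦ lookup f v ⟧ *_) (∑-link v xs (λ g → ⟦ touch (flip v f) g ⟧))))

-- A pair of triples meeting in one, two or three points is counted 1, 2 or 3
-- times through its points, and 0, 2 or 3 times through the links.
τ-triple : ∀ {xs : List (Subset n)} {f x y z} → f ∈ xs → Triple f x y z →
           2 * τ xs f + 1 + (link-τ xs f x + (link-τ xs f y + link-τ xs f z)) ≤ 2 * (deg xs x + (deg xs y + deg xs z))
τ-triple {xs = xs} {f} {x} {y} {z} f∈ t = begin
  2 * τ xs f + 1 + (link-τ xs f x + (link-τ xs f y + link-τ xs f z))
    ≤⟨ +-monoˡ-≤ _ (+-monoʳ-≤ (2 * τ xs f) (#-∈ {P = λ g → lookup g x ∧ (lookup g y ∧ lookup g z)} f∈ (true-∧ (∋x t) (true-∧ (∋y t) (∋z t))))) ⟩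
  2 * τ xs f + deg₃ xs x y z + (link-τ xs f x + (link-τ xs f y + link-τ xs f z))
    ≡⟨ cong₂ _+_ (trans (cong (_+ deg₃ xs x y z) (sym (∑-* xs 2 _))) (sym (∑-+ xs _ _))) (trans (cong (link-τ xs f x +_) (sym (∑-+ xs _ _))) (sym (∑-+ xs _ _))) ⟩
  ∑ xs (λ g → 2 * ⟦ touch f g ⟧ + ⟦ lookup g x ∧ (lookup g y ∧ lookup g z) ⟧) +
  ∑ xs (λ g → ⟦ lookup g x ⟧ * ⟦ touch (flip x f) (flip x g) ⟧ + (⟦ lookup g y ⟧ * ⟦ touch (flip y f) (flip y g) ⟧ + ⟦ lookup g z ⟧ * ⟦ touch (flip z f) (flip z g) ⟧))
    ≡⟨ ∑-+ xs _ _ ⟨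
  ∑ xs (λ g → 2 * ⟦ touch f g ⟧ + ⟦ lookup g x ∧ (lookup g y ∧ lookup g z) ⟧ +
    (⟦ lookup g x ⟧ * ⟦ touch (flip x f) (flip x g) ⟧ + (⟦ lookup g y ⟧ * ⟦ touch (flip y f) (flip y g) ⟧ + ⟦ lookup g z ⟧ * ⟦ touch (flip z f) (flip z g) ⟧)))
    ≡⟨ ∑-cong xs (λ {g} _ → pointwise g) ⟩
  ∑ xs (λ g → 2 * (⟦ lookup g x ⟧ + (⟦ lookup g y ⟧ + ⟦ lookup g z ⟧)))
    ≡⟨ ∑-* xs 2 _ ⟩
  2 * ∑ xs (λ g → ⟦ lookup g x ⟧ + (⟦ lookup g y ⟧ + ⟦ lookup g z ⟧))
    ≡⟨ cong (2 *_) (trans (∑-+ xs _ _) (cong (deg xs x +_) (∑-+ xs _ _))) ⟩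
  2 * (deg xs x + (deg xs y + deg xs z)) ∎
  where
  open ≤-Reasoning
  identity : ∀ a b c → 2 * ⟦ a ∨ (b ∨ c) ⟧ + ⟦ a ∧ (b ∧ c) ⟧ + (⟦ a ⟧ * ⟦ b ∨ c ⟧ + (⟦ b ⟧ * ⟦ a ∨ c ⟧ + ⟦ c ⟧ * ⟦ a ∨ b ⟧)) ≡ 2 * (⟦ a ⟧ + (⟦ b ⟧ + ⟦ c ⟧))
  identity true true true = refl
  identity true true false = refl
  identity true false true = refl
  identity true false false = refl
  identity false true true = refl
  identity false true false = refl
  identity false false true = refl
  identity false false false = refl
  pointwise : ∀ g → 2 * ⟦ touch f g ⟧ + ⟦ lookup g x ∧ (lookup g y ∧ lookup g z) ⟧ +
    (⟦ lookup g x ⟧ * ⟦ touch (flip x f) (flip x g) ⟧ + (⟦ lookup g y ⟧ * ⟦ touch (flip y f) (flip y g) ⟧ + ⟦ lookup g z ⟧ * ⟦ touch (flip z f) (flip z g) ⟧))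
    ≡ 2 * (⟦ lookup g x ⟧ + (⟦ lookup g y ⟧ + ⟦ lookup g z ⟧))
  pointwise g rewrite touch-triple t g | touch-flip t g | touch-flip (swap₁₂ t) g | touch-flip (swap₁₂ (swap₂₃ t)) g =
    identity (lookup g x) (lookup g y) (lookup g z)

triple-of : ∀ {xs : List (Subset n)} → Free 3 xs → ∀ {f} → f ∈ xs → ∃[ x ] ∃[ y ] ∃[ z ] Triple f x y z
triple-of F f∈ = triple _ (uniform F f∈)

∑τ-sum : ∀ {xs : List (Subset n)} → Free 3 xs →
         2 * ∑ xs (τ xs) + length xs + ∑ᶠ (λ v → touching-pairs (link v xs)) ≤ 2 * ∑ᶠ (λ v → deg xs v * deg xs v)
∑τ-sum {xs = xs} F = begin
  2 * ∑ xs (τ xs) + length xs + ∑ᶠ (λ v → touching-pairs (link v xs))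
    ≡⟨ cong₂ _+_ (cong₂ _+_ (∑-* xs 2 (τ xs)) (length-∑ xs)) (sym links) ⟨
  ∑ xs (λ f → 2 * τ xs f) + ∑ xs (λ _ → 1) + ∑ xs (λ f → ∑ᶠ (λ v → ⟦ lookup f v ⟧ * link-τ xs f v))
    ≡⟨ trans (∑-+ xs _ _) (cong (_+ ∑ xs (λ f → ∑ᶠ (λ v → ⟦ lookup f v ⟧ * link-τ xs f v))) (∑-+ xs _ _)) ⟨
  ∑ xs (λ f → 2 * τ xs f + 1 + ∑ᶠ (λ v → ⟦ lookup f v ⟧ * link-τ xs f v))
    ≤⟨ ∑-mono xs (λ f∈ → pointwise f∈ (proj₂ (proj₂ (proj₂ (triple-of F f∈))))) ⟩
  ∑ xs (λ f → 2 * ∑ᶠ (λ v → ⟦ lookup f v ⟧ * deg xs v))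
    ≡⟨ ∑-* xs 2 _ ⟩
  2 * ∑ xs (λ f → ∑ᶠ (λ v → ⟦ lookup f v ⟧ * deg xs v))
    ≡⟨ cong (2 *_) (handshake xs (deg xs)) ⟨
  2 * ∑ᶠ (λ v → deg xs v * deg xs v) ∎
  where
  open ≤-Reasoning
  links : ∑ᶠ (λ v → touching-pairs (link v xs)) ≡ ∑ xs (λ f → ∑ᶠ (λ v → ⟦ lookup f v ⟧ * link-τ xs f v))
  links = trans (∑ᶠ-cong (touching-pairs-link xs)) (∑ᶠ-swap xs (λ v f → ⟦ lookup f v ⟧ * link-τ xs f v))
  pointwise : ∀ {f x y z} → f ∈ xs → Triple f x y z →
    2 * τ xs f + 1 + ∑ᶠ (λ v → ⟦ lookup f v ⟧ * link-τ xs f v) ≤ 2 * ∑ᶠ (λ v → ⟦ lookup f v ⟧ * deg xs v)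
  pointwise {f} f∈ t = begin
    2 * τ xs f + 1 + ∑ᶠ (λ v → ⟦ lookup f v ⟧ * link-τ xs f v)            ≡⟨ cong (2 * τ xs f + 1 +_) (sum t (link-τ xs f)) ⟩
    2 * τ xs f + 1 + (link-τ xs f _ + (link-τ xs f _ + link-τ xs f _))    ≤⟨ τ-triple f∈ t ⟩
    2 * (deg xs _ + (deg xs _ + deg xs _))                                ≡⟨ cong (2 *_) (sum t (deg xs)) ⟨
    2 * ∑ᶠ (λ v → ⟦ lookup f v ⟧ * deg xs v)                              ∎

∑deg₃ : ∀ {xs : List (Subset n)} → Free 3 xs → ∑ᶠ (deg xs) ≡ length xs * 3
∑deg₃ {xs = xs} F = begin
  ∑ᶠ (deg xs)                                          ≡⟨ ∑ᶠ-cong (λ u → *-identityʳ (deg xs u)) ⟨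
  ∑ᶠ (λ u → deg xs u * 1)                              ≡⟨ handshake xs (λ _ → 1) ⟩
  ∑ xs (λ f → ∑ᶠ (λ u → ⟦ lookup f u ⟧ * 1))           ≡⟨ ∑-cong xs (λ {f} f∈ → sum (proj₂ (proj₂ (proj₂ (triple-of F f∈)))) (λ _ → 1)) ⟩
  ∑ xs (λ _ → 3)                                       ≡⟨ ∑-const xs 3 ⟩
  length xs * 3                                        ∎
  where open ≡-Reasoning

-- In five times `∑τ-sum` plus the link bounds, squared degrees and link pairs cancel. The degrees
-- sum to 3 per triple, so 3 · 79 - 5 = 232 remains.
∑τ≤ : ∀ {xs : List (Subset n)} → Free 3 xs → 10 * ∑ xs (τ xs) ≤ 232 * length xs
∑τ≤ {xs = xs} F = linear (+-mono-≤ (*-monoʳ-≤ 5 (∑τ-sum F)) per-vertex)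
  (l (∑ xs (τ xs)) (length xs) (∑ᶠ (λ v → touching-pairs (link v xs))) (∑ᶠ (λ v → deg xs v * deg xs v)))
  where
  l : ∀ t e i d → 10 * t + (5 * (2 * d) + (237 * e + 5 * i)) ≡ 232 * e + (5 * (2 * t + e + i) + 10 * d)
  l = solve-∀
  open ≤-Reasoning
  per-vertex : 10 * ∑ᶠ (λ v → deg xs v * deg xs v) ≤ 237 * length xs + 5 * ∑ᶠ (λ v → touching-pairs (link v xs))
  per-vertex = begin
    10 * ∑ᶠ (λ v → deg xs v * deg xs v)                                    ≡⟨ ∑ᶠ-* 10 (λ v → deg xs v * deg xs v) ⟨
    ∑ᶠ (λ v → 10 * (deg xs v * deg xs v))                                  ≤⟨ ∑ᶠ-mono (λ v → subst (λ d → 10 * (d * d) ≤ 79 * d + 5 * touching-pairs (link v xs))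
                                                                                (length-link v xs) (touching-pairs-lower (link-free v F))) ⟩
    ∑ᶠ (λ v → 79 * deg xs v + 5 * touching-pairs (link v xs))              ≡⟨ ∑ᶠ-+ (λ v → 79 * deg xs v) (λ v → 5 * touching-pairs (link v xs)) ⟩
    ∑ᶠ (λ v → 79 * deg xs v) + ∑ᶠ (λ v → 5 * touching-pairs (link v xs))   ≡⟨ cong₂ _+_ (∑ᶠ-* 79 (deg xs)) (∑ᶠ-* 5 (λ v → touching-pairs (link v xs))) ⟩
    79 * ∑ᶠ (deg xs) + 5 * ∑ᶠ (λ v → touching-pairs (link v xs))           ≡⟨ cong (λ s → 79 * s + 5 * ∑ᶠ (λ v → touching-pairs (link v xs))) (∑deg₃ F) ⟩
    79 * (length xs * 3) + 5 * ∑ᶠ (λ v → touching-pairs (link v xs))       ≡⟨ cong (_+ 5 * ∑ᶠ (λ v → touching-pairs (link v xs))) (l′ (length xs)) ⟩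
    237 * length xs + 5 * ∑ᶠ (λ v → touching-pairs (link v xs))            ∎
    where
    l′ : ∀ e → 79 * (e * 3) ≡ 237 * e
    l′ = solve-∀

-- Graphs on 50 vertices in which every edge lies in at most 10 triangles

module SmallBooks {A : Set} (xs : List A) (adj : A → A → Bool) (adj-sym : ∀ f g → adj f g ≡ adj g f) where

  m : A → ℕ
  m f = # xs (adj f)

  e : A → A → ℕ
  e f g = ∑ xs (λ k → ⟦ adj f k ⟧ * ⟦ adj g k ⟧)

  private
    ⟦sym⟧ : ∀ f g → ⟦ adj f g ⟧ ≡ ⟦ adj g f ⟧
    ⟦sym⟧ f g = cong ⟦_⟧ (adj-sym f g)

    e-sym : ∀ f g → e f g ≡ e g f
    e-sym f g = ∑-cong xs (λ {k} _ → *-comm ⟦ adj f k ⟧ ⟦ adj g k ⟧)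

    -- Sums over ordered edges and over ordered triangles.
    S : (A → A → ℕ) → ℕ
    S h = ∑ xs (λ f → ∑ xs (λ g → ⟦ adj f g ⟧ * h f g))

    Tri : (A → A → A → ℕ) → ℕ
    Tri h = ∑ xs (λ f → ∑ xs (λ g → ∑ xs (λ k → ⟦ adj f g ⟧ * (⟦ adj f k ⟧ * ⟦ adj g k ⟧) * h f g k)))

    S-cong : ∀ {g h} → (∀ a b → g a b ≡ h a b) → S g ≡ S h
    S-cong g≡h = ∑-cong xs (λ {a} _ → ∑-cong xs (λ {b} _ → cong (⟦ adj a b ⟧ *_) (g≡h a b)))

    S-+ : ∀ g h → S (λ a b → g a b + h a b) ≡ S g + S h
    S-+ g h = trans (∑-cong xs (λ {a} _ → trans (∑-cong xs (λ {b} _ → *-distribˡ-+ ⟦ adj a b ⟧ (g a b) (h a b))) (∑-+ xs _ _))) (∑-+ xs _ _)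

    S-* : ∀ c h → S (λ a b → c * h a b) ≡ c * S h
    S-* c h = trans (∑-cong xs (λ {a} _ → trans (∑-cong xs (λ {b} _ → l ⟦ adj a b ⟧ c (h a b))) (∑-* xs c _))) (∑-* xs c _)
      where
      l : ∀ a b c → a * (b * c) ≡ b * (a * c)
      l = solve-∀

    S-swap : ∀ h → S h ≡ S (λ a b → h b a)
    S-swap h = trans (∑-swap xs xs (λ f g → ⟦ adj f g ⟧ * h f g))
      (∑-cong xs (λ {a} _ → ∑-cong xs (λ {b} _ → cong (_* h b a) (⟦sym⟧ b a))))

    S-mono : ∀ {g h} → (∀ {a b} → a ∈ xs → b ∈ xs → adj a b ≡ true → g a b ≤ h a b) → S g ≤ S h
    S-mono {g} {h} g≤h = ∑-mono xs (λ a∈ → ∑-mono xs (λ b∈ → pointwise a∈ b∈))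
      where
      pointwise : ∀ {a b} → a ∈ xs → b ∈ xs → ⟦ adj a b ⟧ * g a b ≤ ⟦ adj a b ⟧ * h a b
      pointwise {a} {b} a∈ b∈ with adj a b in eq
      ... | false = z≤n
      ... | true = +-monoˡ-≤ 0 (g≤h a∈ b∈ eq)

    S-left : ∀ (h : A → ℕ) → S (λ a _ → h a) ≡ ∑ xs (λ a → m a * h a)
    S-left h = ∑-cong xs (λ {a} _ → trans (∑-cong xs (λ {b} _ → *-comm ⟦ adj a b ⟧ (h a))) (trans (∑-* xs (h a) _) (*-comm (h a) (m a))))

    Tri-+ : ∀ g h → Tri (λ a b c → g a b c + h a b c) ≡ Tri g + Tri h
    Tri-+ g h = trans (∑-cong xs (λ {a} _ → trans (∑-cong xs (λ {b} _ →
      trans (∑-cong xs (λ {c} _ → *-distribˡ-+ (⟦ adj a b ⟧ * (⟦ adj a c ⟧ * ⟦ adj b c ⟧)) (g a b c) (h a b c))) (∑-+ xs _ _))) (∑-+ xs _ _))) (∑-+ xs _ _)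

    Tri-mono : ∀ {g h} → (∀ a b c → g a b c ≤ h a b c) → Tri g ≤ Tri h
    Tri-mono g≤h = ∑-mono xs (λ {a} _ → ∑-mono xs (λ {b} _ → ∑-mono xs (λ {c} _ → *-monoʳ-≤ (⟦ adj a b ⟧ * (⟦ adj a c ⟧ * ⟦ adj b c ⟧)) (g≤h a b c))))

    Tri-swap₂₃ : ∀ h → Tri h ≡ Tri (λ a b c → h a c b)
    Tri-swap₂₃ h = ∑-cong xs (λ {a} _ → trans (∑-swap xs xs (λ b c → ⟦ adj a b ⟧ * (⟦ adj a c ⟧ * ⟦ adj b c ⟧) * h a b c))
      (∑-cong xs (λ {b} _ → ∑-cong xs (λ {c} _ → cong (_* h a c b)
        (trans (cong (λ t → ⟦ adj a c ⟧ * (⟦ adj a b ⟧ * t)) (⟦sym⟧ c b)) (l ⟦ adj a c ⟧ ⟦ adj a b ⟧ ⟦ adj b c ⟧))))))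
      where
      l : ∀ a b c → a * (b * c) ≡ b * (a * c)
      l = solve-∀

    Tri-swap₁₂ : ∀ h → Tri h ≡ Tri (λ a b c → h b a c)
    Tri-swap₁₂ h = trans (∑-swap xs xs (λ a b → ∑ xs (λ c → ⟦ adj a b ⟧ * (⟦ adj a c ⟧ * ⟦ adj b c ⟧) * h a b c)))
      (∑-cong xs (λ {a} _ → ∑-cong xs (λ {b} _ → ∑-cong xs (λ {c} _ → cong (_* h b a c)
        (cong₂ _*_ (⟦sym⟧ b a) (*-comm ⟦ adj b c ⟧ ⟦ adj a c ⟧))))))

    -- The ordered edge `a b` extends to `e a b` ordered triangles.
    Tri-edge : ∀ (h : A → A → ℕ) → Tri (λ a b _ → h a b) ≡ S (λ a b → h a b * e a b)
    Tri-edge h = ∑-cong xs (λ {a} _ → ∑-cong xs (λ {b} _ → trans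
      (∑-cong xs (λ {c} _ → l ⟦ adj a b ⟧ (⟦ adj a c ⟧ * ⟦ adj b c ⟧) (h a b)))
      (trans (∑-* xs (⟦ adj a b ⟧ * h a b) (λ c → ⟦ adj a c ⟧ * ⟦ adj b c ⟧)) (*-assoc ⟦ adj a b ⟧ (h a b) (e a b)))))
      where
      l : ∀ a b c → a * b * c ≡ a * c * b
      l = solve-∀

    ∑m ∑m² ∑me ∑e² ∑e : ℕ
    ∑m = ∑ xs m
    ∑m² = ∑ xs (λ a → m a * m a)
    ∑me = S (λ a b → m a * e a b)
    ∑e² = S (λ a b → e a b * e a b)
    ∑e = S e

    -- Every vertex adjacent to j of the vertices of a triangle is in at least
    -- j − 1 of the three common neighbourhoods.
    triangles : 3 * ∑me ≤ length xs * ∑e + 3 * ∑e²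
    triangles = begin
      3 * ∑me                                             ≡⟨ l₁ ∑me ⟩
      ∑me + ∑me + ∑me                                       ≡⟨ cong₂ _+_ (cong₂ _+_ (sym Tm₁) (sym Tm₂)) (sym Tm₃) ⟩
      Tri (λ a _ _ → m a) + Tri (λ _ b _ → m b) + Tri (λ _ _ c → m c)
        ≡⟨ trans (Tri-+ (λ a b _ → m a + m b) (λ _ _ c → m c)) (cong (_+ Tri (λ _ _ c → m c)) (Tri-+ (λ a _ _ → m a) (λ _ b _ → m b))) ⟨
      Tri (λ a b c → m a + m b + m c)                    ≤⟨ Tri-mono pointwise ⟩
      Tri (λ a b c → length xs + e a b + (e a c + e b c))
        ≡⟨ trans (Tri-+ (λ a b _ → length xs + e a b) (λ a b c → e a c + e b c)) (cong₂ _+_ (Tri-+ (λ _ _ _ → length xs) (λ a b _ → e a b)) (Tri-+ (λ a _ c → e a c) (λ _ b c → e b c))) ⟩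
      Tri (λ _ _ _ → length xs) + Tri (λ a b _ → e a b) + (Tri (λ a _ c → e a c) + Tri (λ _ b c → e b c))
        ≡⟨ cong₂ _+_ (cong₂ _+_ (trans (Tri-edge (λ _ _ → length xs)) (S-* (length xs) e)) Te₁) (cong₂ _+_ Te₂ Te₃) ⟩
      length xs * ∑e + ∑e² + (∑e² + ∑e²)                        ≡⟨ l₂ (length xs * ∑e) ∑e² ⟩
      length xs * ∑e + 3 * ∑e²                              ∎
      where
      open ≤-Reasoning
      l₁ : ∀ a → 3 * a ≡ a + a + a
      l₁ = solve-∀
      l₂ : ∀ t b → t + b + (b + b) ≡ t + 3 * b
      l₂ = solve-∀
      Tm₁ : Tri (λ a _ _ → m a) ≡ ∑me
      Tm₁ = Tri-edge (λ a _ → m a)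
      Tm₂ : Tri (λ _ b _ → m b) ≡ ∑me
      Tm₂ = trans (Tri-swap₁₂ (λ _ b _ → m b)) Tm₁
      Tm₃ : Tri (λ _ _ c → m c) ≡ ∑me
      Tm₃ = trans (Tri-swap₂₃ (λ _ _ c → m c)) Tm₂
      Te₁ : Tri (λ a b _ → e a b) ≡ ∑e²
      Te₁ = Tri-edge e
      Te₂ : Tri (λ a _ c → e a c) ≡ ∑e²
      Te₂ = trans (Tri-swap₂₃ (λ a _ c → e a c)) Te₁
      Te₃ : Tri (λ _ b c → e b c) ≡ ∑e²
      Te₃ = trans (Tri-swap₁₂ (λ _ b c → e b c)) Te₂
      booleans : ∀ a b c → ⟦ a ⟧ + ⟦ b ⟧ + ⟦ c ⟧ ≤ 1 + ⟦ a ⟧ * ⟦ b ⟧ + (⟦ a ⟧ * ⟦ c ⟧ + ⟦ b ⟧ * ⟦ c ⟧)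
      booleans true true true = from-yes (3 ≤? 4)
      booleans true true false = from-yes (2 ≤? 2)
      booleans true false true = from-yes (2 ≤? 2)
      booleans true false false = from-yes (1 ≤? 1)
      booleans false true true = from-yes (2 ≤? 2)
      booleans false true false = from-yes (1 ≤? 1)
      booleans false false true = from-yes (1 ≤? 1)
      booleans false false false = z≤n
      pointwise : ∀ a b c → m a + m b + m c ≤ length xs + e a b + (e a c + e b c)
      pointwise a b c = begin
        m a + m b + m c                                                ≡⟨ trans (∑-+ xs _ _) (cong (_+ m c) (∑-+ xs _ _)) ⟨
        ∑ xs (λ k → ⟦ adj a k ⟧ + ⟦ adj b k ⟧ + ⟦ adj c k ⟧)           ≤⟨ ∑-mono xs (λ {k} _ → booleans (adj a k) (adj b k) (adj c k)) ⟩
        ∑ xs (λ k → 1 + ⟦ adj a k ⟧ * ⟦ adj b k ⟧ + (⟦ adj a k ⟧ * ⟦ adj c k ⟧ + ⟦ adj b k ⟧ * ⟦ adj c k ⟧))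
          ≡⟨ trans (∑-+ xs _ _) (cong₂ _+_ (trans (∑-+ xs _ _) (cong (_+ e a b) (length-∑ xs))) (∑-+ xs _ _)) ⟩
        length xs + e a b + (e a c + e b c)                            ∎

    -- The analogue for edges of the bound on the degrees in a triangle; it covers the edges that
    -- lie in few triangles.
    m+m≤ : ∀ a b → m a + m b ≤ length xs + e a b
    m+m≤ a b = begin
      m a + m b                                           ≡⟨ ∑-+ xs _ _ ⟨
      ∑ xs (λ k → ⟦ adj a k ⟧ + ⟦ adj b k ⟧)              ≤⟨ ∑-mono xs (λ {k} _ → booleans (adj a k) (adj b k)) ⟩
      ∑ xs (λ k → 1 + ⟦ adj a k ⟧ * ⟦ adj b k ⟧)          ≡⟨ trans (∑-+ xs _ _) (cong (_+ e a b) (length-∑ xs)) ⟩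
      length xs + e a b                                   ∎
      where
      open ≤-Reasoning
      booleans : ∀ a b → ⟦ a ⟧ + ⟦ b ⟧ ≤ 1 + ⟦ a ⟧ * ⟦ b ⟧
      booleans true b = ≤-reflexive (cong suc (sym (+-identityʳ ⟦ b ⟧)))
      booleans false b = ⟦⟧-≤1 b

    -- With t = 10 and s ≤ 50 + e this is (10 − e)(3s − 160 − 6e) ≤ 0, moved so
    -- that no subtraction occurs.
    concavity : ∀ e s → e ≤ 10 → s ≤ 50 + e → 30 * s + 160 * e + 6 * (e * e) ≤ 3 * (s * e) + 1600 + 60 * e
    concavity e s e≤10 s≤ = ≤-trans (≤-reflexive (l₁ s e)) (≤-trans
      (subst (λ t → 3 * (t * s) + 160 * e + 6 * (e * e) ≤ 3 * (s * e) + 160 * t + 6 * (t * e)) (m+[n∸m]≡n e≤10) (general (10 ∸ e)))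
      (≤-reflexive (l₂ s e)))
      where
      l₁ : ∀ s e → 30 * s + 160 * e + 6 * (e * e) ≡ 3 * (10 * s) + 160 * e + 6 * (e * e)
      l₁ = solve-∀
      l₂ : ∀ s e → 3 * (s * e) + 1600 + 6 * (10 * e) ≡ 3 * (s * e) + 1600 + 60 * e
      l₂ = solve-∀
      3s≤ : 3 * s ≤ 160 + 6 * e
      3s≤ = ≤-trans (*-monoʳ-≤ 3 s≤) (linear {l = 0} {r = 10 + 3 * e} z≤n (l₃ e))
        where
        l₃ : ∀ e → 3 * (50 + e) + (10 + 3 * e) ≡ 160 + 6 * e + 0
        l₃ = solve-∀
      general : ∀ k → 3 * ((e + k) * s) + 160 * e + 6 * (e * e) ≤ 3 * (s * e) + 160 * (e + k) + 6 * ((e + k) * e)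
      general k = linear (*-monoʳ-≤ k 3s≤) (l₄ e k s)
        where
        l₄ : ∀ e k s → 3 * ((e + k) * s) + 160 * e + 6 * (e * e) + k * (160 + 6 * e) ≡ 3 * (s * e) + 160 * (e + k) + 6 * ((e + k) * e) + k * (3 * s)
        l₄ = solve-∀

  module _ (N≡50 : length xs ≡ 50) (e≤10 : ∀ {a b} → a ∈ xs → b ∈ xs → adj a b ≡ true → e a b ≤ 10) where

    private
      edges : 60 * ∑m² + 160 * ∑e + 6 * ∑e² ≤ 6 * ∑me + 1600 * ∑m + 60 * ∑e
      edges = begin
        60 * ∑m² + 160 * ∑e + 6 * ∑e²
          ≡⟨ cong₂ _+_ (cong₂ _+_ lhs (sym (S-* 160 e))) (sym (S-* 6 (λ a b → e a b * e a b))) ⟩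
        S (λ a b → 30 * (m a + m b)) + S (λ a b → 160 * e a b) + S (λ a b → 6 * (e a b * e a b))
          ≡⟨ trans (S-+ (λ a b → 30 * (m a + m b) + 160 * e a b) (λ a b → 6 * (e a b * e a b))) (cong (_+ S (λ a b → 6 * (e a b * e a b))) (S-+ (λ a b → 30 * (m a + m b)) (λ a b → 160 * e a b))) ⟨
        S (λ a b → 30 * (m a + m b) + 160 * e a b + 6 * (e a b * e a b))
          ≤⟨ S-mono (λ {a} {b} a∈ b∈ ab → concavity (e a b) (m a + m b) (e≤10 a∈ b∈ ab) (subst (λ l → m a + m b ≤ l + e a b) N≡50 (m+m≤ a b))) ⟩
        S (λ a b → 3 * ((m a + m b) * e a b) + 1600 + 60 * e a b)
          ≡⟨ trans (S-+ (λ a b → 3 * ((m a + m b) * e a b) + 1600) (λ a b → 60 * e a b)) (cong (_+ S (λ a b → 60 * e a b)) (S-+ (λ a b → 3 * ((m a + m b) * e a b)) (λ _ _ → 1600))) ⟩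
        S (λ a b → 3 * ((m a + m b) * e a b)) + S (λ _ _ → 1600) + S (λ a b → 60 * e a b)
          ≡⟨ cong₂ _+_ (cong₂ _+_ rhs (trans (S-left (λ _ → 1600)) (trans (∑-cong xs (λ {a} _ → *-comm (m a) 1600)) (∑-* xs 1600 m)))) (S-* 60 e) ⟩
        6 * ∑me + 1600 * ∑m + 60 * ∑e ∎
        where
        open ≤-Reasoning
        l : ∀ q → 30 * (q + q) ≡ 60 * q
        l = solve-∀
        l′ : ∀ q → 3 * (q + q) ≡ 6 * q
        l′ = solve-∀
        lhs : 60 * ∑m² ≡ S (λ a b → 30 * (m a + m b))
        lhs = sym (trans (S-* 30 (λ a b → m a + m b)) (trans (cong (30 *_) (trans (S-+ (λ a _ → m a) (λ _ b → m b))
          (cong₂ _+_ (S-left m) (trans (S-swap (λ _ b → m b)) (S-left m))))) (l ∑m²)))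
        rhs : S (λ a b → 3 * ((m a + m b) * e a b)) ≡ 6 * ∑me
        rhs = trans (S-* 3 (λ a b → (m a + m b) * e a b)) (trans (cong (3 *_) (trans (S-cong (λ a b → *-distribʳ-+ (e a b) (m a) (m b)))
          (trans (S-+ (λ a b → m a * e a b) (λ a b → m b * e a b)) (cong (∑me +_) (trans (S-swap (λ a b → m b * e a b)) (S-cong (λ a b → cong (m a *_) (e-sym b a)))))))) (l′ ∑me))

      -- A substitute for Cauchy-Schwarz, sharpened by integrality: the critical average 26.66...
      -- lies between 26 and 27, with 53 = 26 + 27 and 702 = 26 · 27.
      squares : 53 * ∑m ≤ ∑m² + 702 * 50
      squares = begin
        53 * ∑m                              ≡⟨ ∑-* xs 53 m ⟨
        ∑ xs (λ a → 53 * m a)               ≤⟨ ∑-mono xs (λ {a} _ → square (m a)) ⟩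
        ∑ xs (λ a → m a * m a + 702)        ≡⟨ ∑-+ xs _ _ ⟩
        ∑m² + ∑ xs (λ _ → 702)                ≡⟨ cong (∑m² +_) (trans (∑-const xs 702) (cong (_* 702) N≡50)) ⟩
        ∑m² + 702 * 50                        ∎
        where
        open ≤-Reasoning
        -- (k − 26)(k − 27) ≥ 0 for integers k.
        square : ∀ k → 53 * k ≤ k * k + 702
        square k with k ≤? 26
        ... | yes k≤26 = subst (λ t → (2 * t + 1) * k ≤ k * k + t * (t + 1)) (m+[n∸m]≡n k≤26) (below (26 ∸ k))
          where
          l : ∀ k j → (2 * (k + j) + 1) * k + (j * j + j) ≡ k * k + (k + j) * (k + j + 1) + 0
          l = solve-∀
          below : ∀ j → (2 * (k + j) + 1) * k ≤ k * k + (k + j) * (k + j + 1)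
          below j = linear {l = 0} {r = j * j + j} z≤n (l k j)
        ... | no k≰26 = subst (λ k → 53 * k ≤ k * k + 702) (m+[n∸m]≡n (≰⇒> k≰26)) (linear {l = 0} {r = (k ∸ 27) * (k ∸ 27) + (k ∸ 27)} z≤n (l (k ∸ 27)))
          where
          l : ∀ j → 53 * (27 + j) + (j * j + j) ≡ (27 + j) * (27 + j) + 702 + 0
          l = solve-∀

      -- Adding twice `triangles` to `edges` cancels `∑me`, `∑e` and `∑e²`; the constants of
      -- `concavity` are chosen for this. What is left is 60 ∑m² ≤ 1600 ∑m.
      3∑m²≤80∑m : 3 * ∑m² ≤ 80 * ∑m
      3∑m²≤80∑m = *-cancelˡ-≤ 20 (linear (+-mono-≤ edges (*-monoʳ-≤ 2 (subst (λ l → 3 * ∑me ≤ l * ∑e + 3 * ∑e²) N≡50 triangles))) (l ∑m ∑m² ∑me ∑e² ∑e))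
        where
        l : ∀ m q a b t → 20 * (3 * q) + (6 * a + 1600 * m + 60 * t + 2 * (50 * t + 3 * b)) ≡ 20 * (80 * m) + (60 * q + 160 * t + 6 * b + 2 * (3 * a))
        l = solve-∀

    -- Here 79 = 3 · 53 - 80, and 79 · 1333 = 105307 just exceeds 3 · 702 · 50 = 105300.
    ∑m≤1332 : ∑ xs m ≤ 1332
    ∑m≤1332 = ≮⇒≥ λ 1333≤ → <⇒≱ (from-yes (3 * (702 * 50) <? 79 * 1333)) (≤-trans (*-monoʳ-≤ 79 1333≤) 79∑m≤)
      where
      l : ∀ m q c → 79 * m + (3 * (q + c) + 80 * m) ≡ 3 * c + (3 * (53 * m) + 3 * q)
      l = solve-∀
      79∑m≤ : 79 * ∑m ≤ 3 * (702 * 50)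
      79∑m≤ = linear (+-mono-≤ (*-monoʳ-≤ 3 squares) 3∑m²≤80∑m) (l ∑m ∑m² (702 * 50))

-- Fifty triples contain a 4-sunflower

-- Of the 2500 ordered pairs at most 1332 are disjoint, so at least 1168 touch, against the 1160
-- allowed by `∑τ≤`.
free-≢50 : ∀ {xs : List (Subset n)} → Free 3 xs → length xs ≢ 50
free-≢50 {xs = xs} F len = <⇒≱ (from-yes (11600 <? 11680)) (begin
  10 * 1168                ≤⟨ *-monoʳ-≤ 10 (+-cancelˡ-≤ 1332 1168 _ (≤-trans (≤-reflexive (sym total)) (+-monoˡ-≤ (∑ xs (τ xs)) (∑m≤1332 len common≤10)))) ⟩
  10 * ∑ xs (τ xs)         ≤⟨ ∑τ≤ F ⟩
  232 * length xs          ≡⟨ cong (232 *_) len ⟩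
  11600                    ∎)
  where
  open ≤-Reasoning
  open SmallBooks xs miss (λ f g → cong not (touch-sym f g))
  total : ∑ xs m + ∑ xs (τ xs) ≡ 50 * 50
  total = trans (sym (∑-+ xs m (τ xs))) (trans (∑-cong xs (λ {f} _ → trans (+-comm (m f) (τ xs f)) (trans (sym (length-split xs (touch f))) len)))
    (trans (∑-const xs 50) (cong (_* 50) {length xs} {50} len)))
  common≤10 : ∀ {f g} → f ∈ xs → g ∈ xs → miss f g ≡ true → e f g ≤ 10
  common≤10 {f} {g} f∈ g∈ fg = begin
    e f g                                            ≡⟨ ∑-cong xs (λ {k} _ → ⟦∧⟧ (miss f k) (miss g k)) ⟨
    # xs common                                      ≡⟨ length-select common xs ⟨
    length (select common xs)                        ≤⟨ Intersecting.length≤10 (select-free common F) meets ⟩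
    10                                               ∎
    where
    common : Subset _ → Bool
    common k = miss f k ∧ miss g k
    meets : ∀ {h k} → h ∈ select common xs → k ∈ select common xs → touch h k ≡ true
    meets {h} {k} h∈ k∈ = [ id , (λ hk →
      let h∈xs , p = ∈-select⁻ common xs h∈ ; k∈xs , q = ∈-select⁻ common xs k∈
          fh , gh = ∧-true {miss f h} p ; fk , gk = ∧-true {miss f k} q
      in ⊥-elim (no-4-disjoint F (f ∷ g ∷ h ∷ k ∷ []) refl (f∈ ∷ g∈ ∷ h∈xs ∷ k∈xs ∷ [])
        ((not-true fg ∷ not-true fh ∷ not-true fk ∷ []) ∷ (not-true gh ∷ not-true gk ∷ []) ∷ (hk ∷ []) ∷ [] ∷ []))) ]′ (true? (touch h k))

free-≤49 : ∀ {xs : List (Subset n)} → Free 3 xs → length xs ≤ 49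
free-≤49 {xs = xs} F = ≮⇒≥ λ 50≤ → free-≢50 (take-free 50 F) (length-take-≤ 50 xs 50≤)

-- Deciding sunflowers, and the passage between lists and `Family`

Sunflower₄ : Subset n → Subset n → Subset n → Subset n → Set
Sunflower₄ a b c d = Unique (a ∷ b ∷ c ∷ d ∷ []) × AllPairs (λ f g → f ∩ g ≡ a ∩ b) (a ∷ b ∷ c ∷ d ∷ [])

-- The core can only be `a ∩ b`, so no quantifier over cores remains and the search over four
-- members is decidable.
HasSunflower : List (Subset n) → Set
HasSunflower xs = Any (λ a → Any (λ b → Any (λ c → Any (Sunflower₄ a b c) xs) xs) xs) xs

unique? : (xs : List (Subset n)) → Dec (Unique xs)
unique? = AllPairs.allPairs? (λ f g → ¬? (f ≟ˢ g))

hasSunflower? : (xs : List (Subset n)) → Dec (HasSunflower xs)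
hasSunflower? xs = Any.any? (λ a → Any.any? (λ b → Any.any? (λ c → Any.any? (λ d →
  unique? (a ∷ b ∷ c ∷ d ∷ []) ×-dec AllPairs.allPairs? (λ f g → (f ∩ g) ≟ˢ (a ∩ b)) (a ∷ b ∷ c ∷ d ∷ [])) xs) xs) xs) xs

¬hasSunflower⇒free : ∀ {xs : List (Subset n)} → ¬ HasSunflower xs → SunflowerFree xs
¬hasSunflower⇒free ¬sun C (a ∷ b ∷ c ∷ d ∷ []) refl (a∈ ∷ b∈ ∷ c∈ ∷ d∈ ∷ []) ys! pairs@((ab ∷ _) ∷ _) =
  ¬sun (lose a∈ (lose b∈ (lose c∈ (lose d∈ (ys! , AllPairs.map (λ fg → trans fg (sym ab)) pairs)))))

AllPairs-lookup : ∀ {A : Set} {R : A → A → Set} → (∀ {x y} → R x y → R y x) → ∀ {xs} → AllPairs R xs →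
                  ∀ i j → i ≢ j → R (List.lookup xs i) (List.lookup xs j)
AllPairs-lookup R-sym (p ∷ ps) zero zero i≢j = ⊥-elim (i≢j refl)
AllPairs-lookup R-sym (p ∷ ps) zero (suc j) _ = All.lookup p (∈-lookup j)
AllPairs-lookup R-sym (p ∷ ps) (suc i) zero _ = R-sym (All.lookup p (∈-lookup i))
AllPairs-lookup R-sym (p ∷ ps) (suc i) (suc j) i≢j = AllPairs-lookup R-sym ps i j (i≢j ∘ cong suc)

hasSunflower⇒contains : ∀ (F : Family n) → HasSunflower (members F) → ContainsSunflower 4 F
hasSunflower⇒contains F sun with find sun
... | a , a∈ , sun₁ with find sun₁
... | b , b∈ , sun₂ with find sun₂
... | c , c∈ , sun₃ with find sun₃
... | d , d∈ , ys! , pairs = List.lookup ys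
    , ((λ {i} {j} eq → decidable-stable (i Fin.≟ j) λ i≢j → AllPairs-lookup (_∘ sym) ys! i j i≢j eq)
      , a ∩ b , AllPairs-lookup (λ {f} {g} fg → trans (∩-comm g f) fg) pairs)
    , λ i → All.lookup {P = _∈ members F} {xs = ys} (a∈ ∷ b∈ ∷ c∈ ∷ d∈ ∷ []) (∈-lookup i)
  where
  ys = a ∷ b ∷ c ∷ d ∷ []

free⇒¬contains : ∀ (F : Family n) → SunflowerFree (members F) → ¬ ContainsSunflower 4 F
free⇒¬contains F free (A , (injective , C , core) , A∈) =
  free C (List.tabulate A) refl (All.tabulate⁺ A∈) (AllPairs.tabulate⁺ (λ i≢j → i≢j ∘ injective)) (AllPairs.tabulate⁺ (λ {i} {j} → core i j))

family-free : ∀ (F : Family n) → Uniform 3 F → ¬ HasSunflower (members F) → Free 3 (members F)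
family-free F uni ¬sun = record { unique = distinct F ; uniform = All.lookup uni ; free = ¬hasSunflower⇒free ¬sun }

size-50 : ∀ (F : Family n) → Uniform 3 F → size F ≡ 50 → ContainsSunflower 4 F
size-50 F uni size≡50 with hasSunflower? (members F)
... | yes sun = hasSunflower⇒contains F sun
... | no ¬sun = ⊥-elim (free-≢50 (family-free F uni ¬sun) size≡50)

-- Removing unused points of the ground set

skip : Fin (suc n) → Subset n → Subset (suc n)
skip v f = insertAt f v false

skip-injective : ∀ (v : Fin (suc n)) {f g} → skip v f ≡ skip v g → f ≡ g
skip-injective zero eq = Vec.∷-injectiveʳ eq
skip-injective (suc v) {a ∷ f} {b ∷ g} eq = cong₂ _∷_ (Vec.∷-injectiveˡ eq) (skip-injective v (Vec.∷-injectiveʳ eq))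

skip-∩ : ∀ (v : Fin (suc n)) f g → skip v f ∩ skip v g ≡ skip v (f ∩ g)
skip-∩ zero f g = refl
skip-∩ (suc v) (a ∷ f) (b ∷ g) = cong (_ ∷_) (skip-∩ v f g)

∣skip∣ : ∀ (v : Fin (suc n)) f → ∣ skip v f ∣ ≡ ∣ f ∣
∣skip∣ zero f = refl
∣skip∣ (suc v) (true ∷ f) = cong suc (∣skip∣ v f)
∣skip∣ (suc v) (false ∷ f) = ∣skip∣ v f

skip-surjective : ∀ (v : Fin (suc n)) f → f ∌ v → ∃[ g ] skip v g ≡ f
skip-surjective zero (false ∷ f) refl = f , refl
skip-surjective {suc n} (suc v) (a ∷ f) fv = let g , eq = skip-surjective v f fv in a ∷ g , cong (a ∷_) eq

skip-surjective-list : ∀ (v : Fin (suc n)) xs → (∀ {f} → f ∈ xs → f ∌ v) → ∃[ ys ] map (skip v) ys ≡ xs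
skip-surjective-list v [] _ = [] , refl
skip-surjective-list v (f ∷ xs) ∌v =
  let g , p = skip-surjective v f (∌v (here refl)) ; ys , q = skip-surjective-list v xs (∌v ∘ there) in g ∷ ys , cong₂ _∷_ p q

free-skip⁻ : ∀ {w} (v : Fin (suc n)) ys → Free w (map (skip v) ys) → Free w ys
free-skip⁻ v ys F = record
  { unique = Unique.map⁻ (unique F)
  ; uniform = λ {f} f∈ → trans (sym (∣skip∣ v f)) (uniform F (∈-map⁺ (skip v) f∈))
  ; free = λ C zs len zs∈ zs! core → free F (skip v C) (map (skip v) zs) (trans (length-map (skip v) zs) len)
      (All.map⁺ (All.map (∈-map⁺ (skip v)) zs∈)) (Unique.map⁺ (skip-injective v) zs!)
      (AllPairs.map⁺ (AllPairs.map (λ {f} {g} fg → trans (skip-∩ v f g) (cong (skip v) fg)) core))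
  }

∑ᶠ-≥ : (h : Fin n → ℕ) → (∀ u → 1 ≤ h u) → n ≤ ∑ᶠ h
∑ᶠ-≥ {zero} h _ = z≤n
∑ᶠ-≥ {suc n} h 1≤h = +-mono-≤ (1≤h zero) (∑ᶠ-≥ (h ∘ suc) (1≤h ∘ suc))

-- Bounding the ground set by 147 = 3 · 49 points makes the existence of a free family of size `m` a
-- finite question.
SmallGround : ℕ → Set
SmallGround m = ∃[ n ] n < 148 × ∃[ xs ] length xs ≡ m × Free {n} 3 xs

-- There are at most 147 incidences, so on 148 or more points some point is in no member and can be
-- deleted.
compress : ∀ n {m} (xs : List (Subset n)) → length xs ≡ m → Free 3 xs → SmallGround m
compress n xs len F with n <? 148
... | yes n<148 = n , n<148 , xs , len , F
compress zero xs len F | no n≮148 = ⊥-elim (n≮148 (s≤s z≤n))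
compress (suc n) xs len F | no n≮148 with Fin.any? (λ v → deg xs v ≟ⁿ 0)
... | no used = ⊥-elim (n≮148 (s≤s (begin
    suc n              ≤⟨ ∑ᶠ-≥ (deg xs) (λ u → n≢0⇒n>0 (λ eq → used (u , eq))) ⟩
    ∑ᶠ (deg xs)        ≡⟨ ∑deg₃ F ⟩
    length xs * 3      ≤⟨ *-monoˡ-≤ 3 (free-≤49 F) ⟩
    147                ∎)))
  where open ≤-Reasoning
... | yes (v , unused) with skip-surjective-list v xs (λ f∈ → ≢true λ fv → <⇒≱ (#-∈ {P = λ f → lookup f v} f∈ fv) (≤-reflexive unused))
... | ys , refl = compress n ys (trans (sym (length-map (skip v) ys)) len) (free-skip⁻ v ys F)

-- Existence of the maximum by exhaustive search

anyList? : ∀ m {P : List (Subset n) → Set} → Decidable P → Dec (∃[ xs ] length xs ≡ m × P xs)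
anyList? zero P? = map′ (λ p → [] , refl , p) (λ { ([] , refl , p) → p }) (P? [])
anyList? (suc m) P? = map′ (λ (x , xs , len , p) → x ∷ xs , cong suc len , p) (λ { (x ∷ xs , len , p) → x , xs , suc-injective len , p })
  (anySubset? (λ x → anyList? m (λ xs → P? (x ∷ xs))))

free? : ∀ w (xs : List (Subset n)) → Dec (Free w xs)
free? w xs = map′
  (λ (u , a , ¬sun) → record { unique = u ; uniform = All.lookup a ; free = ¬hasSunflower⇒free ¬sun })
  (λ F → unique F , All.tabulate (uniform F) , λ sun → free⇒¬contains (record { members = xs ; distinct = unique F }) (free F) (hasSunflower⇒contains (record { members = xs ; distinct = unique F }) sun))
  (unique? xs ×-dec (All.all? (λ f → ∣ f ∣ ≟ⁿ w) xs ×-dec ¬? (hasSunflower? xs)))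

smallGround? : Decidable SmallGround
smallGround? m = anyUpTo? (λ n → anyList? {n} m (free? 3)) 148

largest : ∀ {P : ℕ → Set} → Decidable P → P 0 → ∀ b → ∃[ m ] P m × m ≤ b × (∀ {k} → P k → k ≤ b → k ≤ m)
largest P? P0 zero = 0 , P0 , z≤n , λ _ k≤ → k≤
largest {P} P? P0 (suc b) with P? (suc b) | largest P? P0 b
... | yes Pb | _ = suc b , Pb , ≤-refl , λ _ k≤ → k≤
... | no ¬Pb | m , Pm , m≤b , max = m , Pm , m≤n⇒m≤1+n m≤b , λ {k} Pk k≤ →
  [ (λ { (s≤s k≤b) → max Pk k≤b }) , (λ { refl → ⊥-elim (¬Pb Pk) }) ]′ (m≤n⇒m<n∨m≡n k≤)

empty-smallGround : SmallGround 0
empty-smallGround = 0 , s≤s z≤n , [] , refl , record { unique = [] ; uniform = λ () ; free = λ { C (_ ∷ _) _ (() ∷ _) } }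

largest⇒number : (∃[ m ] SmallGround m × m ≤ 49 × (∀ {k} → SmallGround k → k ≤ 49 → k ≤ m)) → ∃[ m ] (IsSunflowerNumber 3 4 m × m ≤ 49)
largest⇒number (m , (n , _ , xs , len , F) , m≤49 , max) = m , (attained , bound) , m≤49
  where
  G : Family n
  G = record { members = xs ; distinct = unique F }
  attained : ∃[ n ] ∃[ G ] (Uniform {n} 3 G × ¬ ContainsSunflower 4 G × size G ≡ m)
  attained = n , G , All.tabulate (uniform F) , free⇒¬contains G (free F) , len
  bound : ∀ n (G : Family n) → Uniform 3 G → ¬ ContainsSunflower 4 G → size G ≤ m
  -- Compression brings a family on any ground set within the range of the search, and `free-≤49`
  -- does the same for its size.
  bound n G uni ¬sun = max (compress n (members G) refl H) (free-≤49 H)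
    where
    H : Free 3 (members G)
    H = family-free G uni (¬sun ∘ hasSunflower⇒contains G)

theorem5p10 : (∀ (n : ℕ) (F : Family n) → Uniform 3 F → size F ≡ 50 → ContainsSunflower 4 F)
    × (∃[ m ] (IsSunflowerNumber 3 4 m × m ≤ 49))
theorem5p10 = (λ n → size-50) , largest⇒number (largest smallGround? empty-smallGround 49)
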